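{- Let $k>3$ be an integer. For every $v\geq 4k$ with $v(v-1)\equiv 0\pmod{2k}$, \[\mathcal{L}_1S_k(v)=\{n\geq v-1\mid n\equiv 0,1\pmod 4\}.\]
   Context: All graphs are finite and simple; $\Gamma\leq K$ means $\Gamma$ is a subgraph of $K$ (or is isomorphic to one, when $\Gamma$ is an abstract graph). $P_3$ is the path on $3$ vertices; $S_k$ is the star on $k+1$ vertices, i.e. the complete bipartite graph $K_{1,k}$. For a graph $K$ and $\Gamma\leq K$, a $(K,\Gamma)$-design is a set $\mathcal{B}$ of subgraphs of $K$, called blocks, each isomorphic to $\Gamma$, whose edge-sets partition $E(K)$. $K_n$ is the complete graph on a set of $n$ vertices (any $n$-element vertex set may be used); a $\Gamma$-design of order $n$ is a $(K_n,\Gamma)$-design. Given $\Gamma'\leq\Gamma$, a $(K,\Gamma)$-design $\mathcal{B}$ and a $(K',\Gamma')$-design $\mathcal{B}'$, a down-link from $\mathcal{B}$ to $\mathcal{B}'$ is a function $f:\mathcal{B}\to\mathcal{B}'$ such that $f(B)$ is a subgraph of $B$ for every $B\in\mathcal{B}$ (the vertex sets of $K$ and $K'$ need not coincide, and either may be the larger). Take $\Gamma'=P_3$. For $v$ such that a $(K_v,\Gamma)$-design exists, $\mathcal{L}_1\Gamma(v)$ is the set of all integers $n$ such that some $\Gamma$-design of order $v$ can be down-linked to a $P_3$-design of order $n$. A $(K_v,S_k)$-design exists if and only if $v\geq 2k$ and $v(v-1)\equiv 0\pmod{2k}$. -}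

module Defs where

open import Data.Empty using (⊥)
open import Data.Fin using (Fin; zero; suc; toℕ)
open import Data.List using (List; length; allFin)
open import Data.List.Membership.Propositional using (_∈_)
open import Data.List.Membership.Propositional.Properties using (∈-allFin)
open import Data.List.Relation.Binary.Subset.Propositional using (_⊆_)
open import Data.List.Relation.Unary.Unique.Propositional using (Unique)
open import Data.List.Relation.Unary.Unique.Propositional.Properties using (allFin⁺)
open import Data.Nat using (ℕ; suc; _≟_)
open import Data.Nat.Properties using (1+n≢n)
open import Data.List.Membership.DecPropositional _≟_ using (_∈?_)
open import Data.Product using (Σ; ∃; ∃!; _×_; _,_; proj₁)
open import Data.Sum using (_⊎_; inj₁; inj₂; swap)
open import Data.Unit using (⊤; tt)
open import Function.Bundles using (Inverse; _⇔_)
open import Level using (0ℓ)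
open import Relation.Binary.Bundles using (Setoid)
open import Relation.Binary.Core using (Rel; _⇒_)
open import Relation.Binary.Definitions using (Symmetric; Irreflexive; Decidable)
import Relation.Binary.Construct.On as On
open import Relation.Binary.PropositionalEquality using (_≡_; _≢_; refl; sym; setoid)
open import Relation.Nullary using (yes; no; ¬?; _×-dec_; _⊎-dec_)
open import Relation.Unary using (Pred)

-- A is an ambient type of labels: the vertex set is only the list `vertices`,
-- so that graphs on different (possibly overlapping) vertex sets can be compared.
record Graph (A : Set) : Set₁ where
  field
    vertices   : List A
    unique     : Unique vertices
    Adj        : Rel A 0ℓ
    adj?       : Decidable Adj
    adj-sym    : Symmetric Adj
    adj-irrefl : Irreflexive _≡_ Adj
    adj⇒∈      : ∀ {x y} → Adj x y → x ∈ vertices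

open Graph public

module _ {A : Set} where

  infix 4 _≤ᴳ_ _≈ᴳ_

  _≤ᴳ_ : Graph A → Graph A → Set
  G ≤ᴳ H = vertices G ⊆ vertices H × Adj G ⇒ Adj H

  _≈ᴳ_ : Graph A → Graph A → Set
  G ≈ᴳ H = G ≤ᴳ H × H ≤ᴳ G

  -- Vertices are compared by their labels, ignoring the membership proofs.
  Vertex : Graph A → Setoid 0ℓ 0ℓ
  Vertex G = On.setoid {B = ∃ (_∈ vertices G)} (setoid A) proj₁

infix 4 _≅_

record _≅_ {A B : Set} (G : Graph A) (H : Graph B) : Set where
  field
    bijection : Inverse (Vertex G) (Vertex H)
  open Inverse bijection public
  field
    adj⇔adj : ∀ x y → Adj G (proj₁ x) (proj₁ y) ⇔ Adj H (proj₁ (to x)) (proj₁ (to y))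

Path : ∀ n → Graph (Fin n)
Path n = record
  { vertices   = allFin n
  ; unique     = allFin⁺ n
  ; Adj        = λ i j → suc (toℕ i) ≡ toℕ j ⊎ suc (toℕ j) ≡ toℕ i
  ; adj?       = λ i j → (suc (toℕ i) ≟ toℕ j) ⊎-dec (suc (toℕ j) ≟ toℕ i)
  ; adj-sym    = swap
  ; adj-irrefl = λ { refl (inj₁ p) → 1+n≢n p ; refl (inj₂ p) → 1+n≢n p }
  ; adj⇒∈      = λ {i} _ → ∈-allFin i
  }

StarAdj : ∀ {k} → Rel (Fin (suc k)) 0ℓ
StarAdj zero    zero    = ⊥
StarAdj zero    (suc _) = ⊤
StarAdj (suc _) zero    = ⊤
StarAdj (suc _) (suc _) = ⊥

Star : ∀ k → Graph (Fin (suc k))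
Star k = record
  { vertices   = allFin (suc k)
  ; unique     = allFin⁺ (suc k)
  ; Adj        = StarAdj
  ; adj?       = dec
  ; adj-sym    = λ {i} {j} → symm i j
  ; adj-irrefl = λ { {i} refl → irr i }
  ; adj⇒∈      = λ {i} _ → ∈-allFin i
  }
  where
  dec : Decidable (StarAdj {k})
  dec zero    zero    = no λ ()
  dec zero    (suc _) = yes tt
  dec (suc _) zero    = yes tt
  dec (suc _) (suc _) = no λ ()

  symm : (i j : Fin (suc k)) → StarAdj i j → StarAdj j i
  symm zero    (suc _) _ = tt
  symm (suc _) zero    _ = tt

  irr : (i : Fin (suc k)) → StarAdj i i → ⊥
  irr zero    ()
  irr (suc _) ()

Complete : (vs : List ℕ) → Unique vs → Graph ℕ
Complete vs u = record
  { vertices   = vs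
  ; unique     = u
  ; Adj        = λ x y → x ∈ vs × y ∈ vs × x ≢ y
  ; adj?       = λ x y → (x ∈? vs) ×-dec (y ∈? vs) ×-dec ¬? (x ≟ y)
  ; adj-sym    = λ (x∈ , y∈ , x≢y) → y∈ , x∈ , λ y≡x → x≢y (sym y≡x)
  ; adj-irrefl = λ x≡y (_ , _ , x≢y) → x≢y x≡y
  ; adj⇒∈      = proj₁
  }

-- The set of blocks is an indexed family, made repetition-free by `distinct`.
record Design {A B : Set} (K : Graph A) (Γ : Graph B) : Set₁ where
  field
    size      : ℕ
    block     : Fin size → Graph A
    block-≤   : ∀ i → block i ≤ᴳ K
    block-≅   : ∀ i → block i ≅ Γ
    distinct  : ∀ {i j} → block i ≈ᴳ block j → i ≡ j
    partition : ∀ {x y} → Adj K x y → ∃! _≡_ λ i → Adj (block i) x y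

open Design public

-- Labels are taken from ℕ: any two finite vertex sets, with any overlap, can be
-- relabelled simultaneously by natural numbers.
record DesignOfOrder (n : ℕ) {B : Set} (Γ : Graph B) : Set₁ where
  field
    points   : List ℕ
    distinct-points : Unique points
    order    : length points ≡ n
    design   : Design (Complete points distinct-points) Γ

open DesignOfOrder public

DownLink : {A B C : Set} {K K′ : Graph A} {Γ : Graph B} {Γ′ : Graph C} →
           Design K Γ → Design K′ Γ′ → Set
DownLink 𝓑 𝓑′ = Σ (Fin (size 𝓑) → Fin (size 𝓑′)) λ f →
  ∀ i → block 𝓑′ (f i) ≤ᴳ block 𝓑 i

𝓛₁ : {B : Set} → Graph B → ℕ → Pred ℕ _
𝓛₁ Γ v n = Σ (DesignOfOrder v Γ) λ 𝓑 → Σ (DesignOfOrder n (Path 3)) λ 𝓑′ →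
  DownLink (design 𝓑) (design 𝓑′)

{-# OPTIONS --safe #-}

-- Necessity: the middle vertex of a P₃ inside a star is the centre of the star, so every centre is a point
-- of the P₃-design, and at most one vertex is a centre of no star. Counting arcs gives 4 ∣ n(n-1).
--
-- Sufficiency: an S_k-design amounts to an orientation with out-degrees divisible by k, a P₃-design to one
-- with even out-degrees. Let w = v-1 and let q, r be the quotient and remainder of v(v-1)/2k by w. By
-- Landau's theorem there is a tournament on w vertices with scores k m - 1, where m = q + 1 for r of the
-- vertices and m = q for the others; adding a common out-neighbour gives the stars. In the tournament any
-- vertex x reaches a fixed vertex of least score along at most two arcs; since k > 3, reserving the first of
-- them leaves at least 2m out-neighbours of x, from which each of the m stars at x receives its P₃.
-- Reversing some of the reserved arcs then makes all out-degrees on n ≥ w vertices even, and the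
-- out-neighbours left over at each vertex are paired arbitrarily.

module Submission where

open import Defs
open import Data.Bool using (Bool; true; false; not; if_then_else_; _∧_) renaming (_≟_ to _≟ᵇ_)
open import Data.Empty using (⊥; ⊥-elim)
open import Data.Fin using (Fin; zero; suc; _↑ˡ_; _↑ʳ_; splitAt; combine; remQuot; punchIn; punchOut)
open import Data.Fin.Properties using (splitAt-↑ˡ; splitAt-↑ʳ; splitAt⁻¹-↑ˡ; splitAt⁻¹-↑ʳ; any?; combine-remQuot; combine-injective; injective⇒≤; punchIn-injective; punchInᵢ≢i; punchIn-punchOut)
open import Data.List using (List; []; _∷_; map; allFin; upTo; length; lookup)
open import Data.List.Membership.Propositional using (_∈_; find; lose)
open import Data.List.Membership.Propositional.Properties using (∈-allFin; ∈-lookup; ∈-map⁺; ∈-map⁻; ∈-upTo⁺; ∈-upTo⁻)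
open import Data.List.Properties using (length-upTo)
open import Data.List.Relation.Binary.Subset.Propositional using (_⊆_)
import Data.List.Relation.Unary.All as All
open import Data.List.Relation.Unary.AllPairs using (_∷_)
open import Data.List.Relation.Unary.Any using (here; there; index)
import Data.List.Relation.Unary.Any as Any
open import Data.List.Relation.Unary.Any.Properties using (lookup-index)
open import Data.List.Relation.Unary.Unique.Propositional using (Unique)
open import Data.List.Relation.Unary.Unique.Propositional.Properties using (upTo⁺; map⁺)
open import Data.Nat using (ℕ; zero; suc; pred; _+_; _*_; _∸_; _⊔_; _≤_; _<_; _≥_; z≤n; s≤s; _≟_; _≤?_; _<?_; _/_; _%_; NonZero; >-nonZero; >-nonZero⁻¹)
open import Data.List.Membership.DecPropositional _≟_ using (_∈?_)
open import Data.Nat.Divisibility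
open import Data.Nat.DivMod using (m≡m%n+[m/n]*n; m%n<n; m/n*n≡m)
open import Data.Nat.Properties hiding (suc-injective)
open import Data.Nat.Tactic.RingSolver using (solve-∀)
open import Data.Product using (Σ; ∃; ∃₂; _×_; _,_; proj₁; proj₂)
open import Data.Product.Properties using (,-injective)
open import Data.Sum as Sum using (_⊎_; inj₁; inj₂; [_,_]; [_,_]′)
open import Data.Unit using (tt)
open import Function using (_∘_; _$_)
open import Function.Bundles using (mk⇔; Equivalence)
import Function.Construct.Composition as Composition
import Function.Construct.Identity as Identity
open import Relation.Binary.PropositionalEquality hiding ([_])
open import Relation.Nullary using (¬_; Dec; yes; no; does; contradiction; _×-dec_; _⊎-dec_; ¬?)
open import Relation.Nullary.Decidable using (dec-true; dec-false; decidable-stable)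
open import Relation.Unary using (Decidable; _∪_; _≐_)

-- Bounded search and finite sums.

least : ∀ {P : ℕ → Set} → Decidable P → ∀ t →
        (∃ λ x → x < t × P x × (∀ {j} → j < x → ¬ P j)) ⊎ (∀ {j} → j < t → ¬ P j)
least P? zero = inj₂ λ ()
least P? (suc t) with least P? t
... | inj₁ (x , x<t , px , min) = inj₁ (x , m<n⇒m<1+n x<t , px , min)
... | inj₂ none with P? t
...   | yes pt = inj₁ (t , n<1+n t , pt , none)
...   | no ¬pt = inj₂ λ j<1+t → [ none , (λ { refl → ¬pt }) ] (m<1+n⇒m<n∨m≡n j<1+t)

sum< : ℕ → (ℕ → ℕ) → ℕ
sum< zero    f = 0
sum< (suc t) f = sum< t f + f t

sum-cong : ∀ t {f g : ℕ → ℕ} → (∀ {i} → i < t → f i ≡ g i) → sum< t f ≡ sum< t g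
sum-cong zero    eq = refl
sum-cong (suc t) eq = cong₂ _+_ (sum-cong t (eq ∘ m<n⇒m<1+n)) (eq (n<1+n t))

sum-mono : ∀ t {f g : ℕ → ℕ} → (∀ {i} → i < t → f i ≤ g i) → sum< t f ≤ sum< t g
sum-mono zero    le = z≤n
sum-mono (suc t) le = +-mono-≤ (sum-mono t (le ∘ m<n⇒m<1+n)) (le (n<1+n t))

sum-mono-< : ∀ t {f g : ℕ → ℕ} → (∀ {i} → i < t → f i ≤ g i) →
             ∀ {j} → j < t → f j < g j → sum< t f < sum< t g
sum-mono-< (suc t) le j<1+t lt with m<1+n⇒m<n∨m≡n j<1+t
... | inj₁ j<t  = +-mono-<-≤ (sum-mono-< t (le ∘ m<n⇒m<1+n) j<t lt) (le (n<1+n t))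
... | inj₂ refl = +-mono-≤-< (sum-mono t (le ∘ m<n⇒m<1+n)) lt

sum-+ : ∀ t (f g : ℕ → ℕ) → sum< t (λ i → f i + g i) ≡ sum< t f + sum< t g
sum-+ zero    f g = refl
sum-+ (suc t) f g = trans (cong (_+ (f t + g t)) (sum-+ t f g))
                          (lemma (sum< t f) (sum< t g) (f t) (g t))
  where
  lemma : ∀ a b c d → a + b + (c + d) ≡ a + c + (b + d)
  lemma = solve-∀

sum-* : ∀ t c (f : ℕ → ℕ) → sum< t (λ i → c * f i) ≡ c * sum< t f
sum-* zero    c f = sym (*-zeroʳ c)
sum-* (suc t) c f = trans (cong (_+ c * f t) (sum-* t c f)) (sym (*-distribˡ-+ c _ _))

sum-const : ∀ t c → sum< t (λ _ → c) ≡ t * c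
sum-const zero    c = refl
sum-const (suc t) c = trans (cong (_+ c) (sum-const t c)) (+-comm _ c)

sum-swap : ∀ s t (f : ℕ → ℕ → ℕ) →
           sum< s (λ i → sum< t (f i)) ≡ sum< t (λ j → sum< s (λ i → f i j))
sum-swap zero    t f = sym (trans (sum-const t 0) (*-zeroʳ t))
sum-swap (suc s) t f = trans (cong (_+ sum< t (f s)) (sum-swap s t f))
                             (sym (sum-+ t (λ j → sum< s (λ i → f i j)) (f s)))

sum-extend : ∀ {s} t (f : ℕ → ℕ) → s ≤ t → (∀ {i} → s ≤ i → f i ≡ 0) → sum< t f ≡ sum< s f
sum-extend zero f z≤n out = refl
sum-extend {s} (suc t) f s≤1+t out with m≤n⇒m<n∨m≡n s≤1+t
... | inj₂ refl      = refl
... | inj₁ (s≤s s≤t) = trans (cong₂ _+_ (sum-extend t f s≤t out) (out s≤t)) (+-identityʳ _)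

bit : Bool → ℕ
bit true  = 1
bit false = 0

bit-not : ∀ b → bit b + bit (not b) ≡ 1
bit-not true  = refl
bit-not false = refl

δ : ℕ → ℕ → ℕ
δ a i = bit (does (a ≟ i))

δ-≡ : ∀ a → δ a a ≡ 1
δ-≡ a = cong bit (dec-true (a ≟ a) refl)

δ-≢ : ∀ {a i} → a ≢ i → δ a i ≡ 0
δ-≢ {a} {i} a≢i = cong bit (dec-false (a ≟ i) a≢i)

sum-δ-≤ : ∀ {a} t → t ≤ a → sum< t (δ a) ≡ 0
sum-δ-≤ zero    t≤a = refl
sum-δ-≤ (suc t) t<a = cong₂ _+_ (sum-δ-≤ t (<⇒≤ t<a)) (δ-≢ (≢-sym (<⇒≢ t<a)))

sum-δ-> : ∀ {a} t → a < t → sum< t (δ a) ≡ 1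
sum-δ-> (suc t) a<1+t with m<1+n⇒m<n∨m≡n a<1+t
... | inj₁ a<t  = cong₂ _+_ (sum-δ-> t a<t) (δ-≢ (<⇒≢ a<t))
... | inj₂ refl = cong₂ _+_ (sum-δ-≤ t ≤-refl) (δ-≡ t)

count : ℕ → (ℕ → Bool) → ℕ
count t f = sum< t (bit ∘ f)

-- Tournaments, scores and reversal of arcs.

record Tournament (T : ℕ → ℕ → Bool) : Set where
  field
    irrefl : ∀ x → T x x ≡ false
    anti   : ∀ {x y} → x ≢ y → T y x ≡ not (T x y)

  arc⇒≢ : ∀ {x y} → T x y ≡ true → x ≢ y
  arc⇒≢ {x} xy refl with () ← trans (sym xy) (irrefl x)

  asym : ∀ {x y} → T x y ≡ true → T y x ≡ false
  asym xy = trans (anti (arc⇒≢ xy)) (cong not xy)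

  total : ∀ {x y} → x ≢ y → T x y ≡ true ⊎ T y x ≡ true
  total {x} {y} x≢y with T x y in eq
  ... | true  = inj₁ refl
  ... | false = inj₂ (trans (anti x≢y) (cong not eq))

open Tournament

Edge : (a b x y : ℕ) → Set
Edge a b x y = (x ≡ a × y ≡ b) ⊎ (x ≡ b × y ≡ a)

edge-sym : ∀ {a b x y} → Edge a b x y → Edge a b y x
edge-sym (inj₁ (p , q)) = inj₂ (q , p)
edge-sym (inj₂ (p , q)) = inj₁ (q , p)

edge? : ∀ a b x y → Dec (Edge a b x y)
edge? a b x y = ((x ≟ a) ×-dec (y ≟ b)) ⊎-dec ((x ≟ b) ×-dec (y ≟ a))

reverse : (a b : ℕ) → (ℕ → ℕ → Bool) → ℕ → ℕ → Bool
reverse a b T x y = if does (edge? a b x y) then not (T x y) else T x y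

module _ {a b : ℕ} {T : ℕ → ℕ → Bool} where

  reverse-on : ∀ {x y} → Edge a b x y → reverse a b T x y ≡ not (T x y)
  reverse-on {x} {y} e = cong (if_then not (T x y) else T x y) (dec-true (edge? a b x y) e)

  reverse-off : ∀ {x y} → ¬ Edge a b x y → reverse a b T x y ≡ T x y
  reverse-off {x} {y} ¬e = cong (if_then not (T x y) else T x y) (dec-false (edge? a b x y) ¬e)

  reverse-tournament : a ≢ b → Tournament T → Tournament (reverse a b T)
  reverse-tournament a≢b t .irrefl x =
    trans (reverse-off λ { (inj₁ (refl , refl)) → a≢b refl ; (inj₂ (refl , refl)) → a≢b refl })
          (irrefl t x)
  reverse-tournament a≢b t .anti {x} {y} x≢y with edge? a b x y
  ... | yes e = trans (reverse-on (edge-sym e)) (cong not (trans (anti t x≢y) (sym (reverse-on e))))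
  ... | no ¬e = trans (reverse-off (¬e ∘ edge-sym)) (trans (anti t x≢y) (cong not (sym (reverse-off ¬e))))

-- A tournament orients all pairs of naturals and `w` only bounds the counting, so a single `T`
-- serves both for the `w` centres of stars and for the `n ≥ w` points of the P₃-design.
score : ℕ → (ℕ → ℕ → Bool) → ℕ → ℕ
score w T x = count w (T x)

-- One unit of score passes from `x` to `y`, written additively to avoid truncated subtraction.
Transfer : (x y : ℕ) (s s′ : ℕ → ℕ) → Set
Transfer x y s s′ = ∀ i → s′ i + δ x i ≡ s i + δ y i

transfer-trans : ∀ {x y z s s′ s″} → Transfer x z s s′ → Transfer z y s′ s″ → Transfer x y s s″
transfer-trans {x} {y} {z} {s} {s′} {s″} p q i = +-cancelʳ-≡ (δ z i) _ _ $ begin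
  s″ i + δ x i + δ z i   ≡⟨ ac (s″ i) (δ x i) (δ z i) ⟩
  s″ i + δ z i + δ x i   ≡⟨ cong (_+ δ x i) (q i) ⟩
  s′ i + δ y i + δ x i   ≡⟨ ac (s′ i) (δ y i) (δ x i) ⟩
  s′ i + δ x i + δ y i   ≡⟨ cong (_+ δ y i) (p i) ⟩
  s i + δ z i + δ y i    ≡⟨ ac (s i) (δ z i) (δ y i) ⟩
  s i + δ y i + δ z i    ∎
  where
  open ≡-Reasoning
  ac : ∀ a b c → a + b + c ≡ a + c + b
  ac = solve-∀

module _ {w a b : ℕ} {T : ℕ → ℕ → Bool} (t : Tournament T) (a<w : a < w) (b<w : b < w) (ab : T a b ≡ true) where
  private
    a≢b : a ≢ b
    a≢b = arc⇒≢ t ab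

    -- The products of deltas are the indicators of the matrix positions `(a , b)` and `(b , a)`:
    -- the reversal clears the first and sets the second. Summing over `y` gives the change of each
    -- row.
    bits : ∀ x y → bit (reverse a b T x y) + δ a x * δ b y ≡ bit (T x y) + δ b x * δ a y
    bits x y with edge? a b x y
    ... | yes e@(inj₁ (refl , refl))
      rewrite reverse-on {T = T} e | ab | δ-≡ a | δ-≡ b | δ-≢ (≢-sym a≢b) = refl
    ... | yes e@(inj₂ (refl , refl))
      rewrite reverse-on {T = T} e | asym t ab | δ-≡ a | δ-≡ b | δ-≢ a≢b = refl
    ... | no ¬e rewrite reverse-off {T = T} ¬e = cong (bit (T x y) +_) (trans (zero₁ ¬e) (sym (zero₂ ¬e)))
      where
      zero₁ : ¬ Edge a b x y → δ a x * δ b y ≡ 0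
      zero₁ ¬e with a ≟ x | b ≟ y
      ... | no a≢x   | _        = cong (_* δ b y) (δ-≢ a≢x)
      ... | yes _    | no b≢y   = trans (cong (δ a x *_) (δ-≢ b≢y)) (*-zeroʳ (δ a x))
      ... | yes refl | yes refl = contradiction (inj₁ (refl , refl)) ¬e
      zero₂ : ¬ Edge a b x y → δ b x * δ a y ≡ 0
      zero₂ ¬e with b ≟ x | a ≟ y
      ... | no b≢x   | _        = cong (_* δ a y) (δ-≢ b≢x)
      ... | yes _    | no a≢y   = trans (cong (δ b x *_) (δ-≢ a≢y)) (*-zeroʳ (δ b x))
      ... | yes refl | yes refl = contradiction (inj₂ (refl , refl)) ¬e

    weigh : ∀ (f : ℕ → ℕ) c {d} → d < w → sum< w (λ y → f y + c * δ d y) ≡ sum< w f + c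
    weigh f c {d} d<w = trans (sum-+ w f (λ y → c * δ d y)) $ cong (sum< w f +_) $
      trans (sum-* w c (δ d)) (trans (cong (c *_) (sum-δ-> w d<w)) (*-identityʳ c))

  reverse-score : Transfer a b (score w T) (score w (reverse a b T))
  reverse-score x = begin
    score w (reverse a b T) x + δ a x                       ≡⟨ weigh _ _ b<w ⟨
    sum< w (λ y → bit (reverse a b T x y) + δ a x * δ b y)  ≡⟨ sum-cong w (λ {y} _ → bits x y) ⟩
    sum< w (λ y → bit (T x y) + δ b x * δ a y)              ≡⟨ weigh _ _ a<w ⟩
    score w T x + δ b x                                     ∎
    where open ≡-Reasoning

-- Otherwise the out-neighbours of x all lie among those of y, and so does x.
short-path : ∀ {w T x y} → Tournament T → x < w → x ≢ y → score w T y ≤ score w T x →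
             T x y ≡ true ⊎ ∃ λ z → z < w × T x z ≡ true × T z y ≡ true
short-path {w} {T} {x} {y} t x<w x≢y le with total t x≢y
... | inj₁ xy = inj₁ xy
... | inj₂ yx with least {λ z → T x z ≡ true × T y z ≡ false} (λ z → (T x z ≟ᵇ true) ×-dec (T y z ≟ᵇ false)) w
...   | inj₁ (z , z<w , (xz , ¬yz) , _) = inj₂ (z , z<w , xz , zy)
  where
  zy : T z y ≡ true
  zy with total t {z} {y} (λ { refl → contradiction (trans (sym xz) (asym t yx)) λ () })
  ... | inj₁ zy = zy
  ... | inj₂ yz with () ← trans (sym yz) ¬yz
...   | inj₂ none = contradiction (sum-mono-< w below x<w strict) (≤⇒≯ le)
  where
  below : ∀ {i} → i < w → bit (T x i) ≤ bit (T y i)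
  below {i} i<w with T x i in xi | T y i in yi
  ... | false | _     = z≤n
  ... | true  | true  = ≤-refl
  ... | true  | false = contradiction (xi , yi) (none i<w)
  strict : bit (T x x) < bit (T y x)
  strict rewrite irrefl t x | yx = ≤-refl

-- Scores of vertices below `w` do not see these arcs. The condition is carried along so that in the
-- end each `x ≥ w` has an arc straight to vertex 0.
Outside : ℕ → (ℕ → ℕ → Bool) → Set
Outside w T = ∀ {x y} → w ≤ x ⊎ w ≤ y → T x y ≡ does (y <? x)

reverse-outside : ∀ {w a b T} → a < w → b < w → Outside w T → Outside w (reverse a b T)
reverse-outside {T = T} a<w b<w out {x} {y} w≤ = trans (reverse-off {T = T} (λ e → absurd e w≤)) (out w≤)
  where
  absurd : Edge _ _ x y → ¬ (_ ≤ x ⊎ _ ≤ y)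
  absurd (inj₁ (refl , refl)) (inj₁ w≤a) = <⇒≱ a<w w≤a
  absurd (inj₁ (refl , refl)) (inj₂ w≤b) = <⇒≱ b<w w≤b
  absurd (inj₂ (refl , refl)) (inj₁ w≤b) = <⇒≱ b<w w≤b
  absurd (inj₂ (refl , refl)) (inj₂ w≤a) = <⇒≱ a<w w≤a

-- The path of one or two arcs from `x` to `y` is reversed; an intermediate vertex loses one unit
-- and gains one.
move : ∀ {w T x y} → Tournament T → Outside w T → x < w → y < w → x ≢ y →
       score w T y ≤ score w T x →
       ∃ λ T′ → Tournament T′ × Outside w T′ × Transfer x y (score w T) (score w T′)
move {w} {T} {x} {y} t out x<w y<w x≢y le with short-path {T = T} t x<w x≢y le
... | inj₁ xy = reverse x y T , reverse-tournament x≢y t , reverse-outside x<w y<w out ,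
                reverse-score t x<w y<w xy
... | inj₂ (z , z<w , xz , zy) =
  reverse z y T′ , reverse-tournament z≢y t′ ,
  reverse-outside z<w y<w (reverse-outside x<w z<w out) ,
  transfer-trans {x} {y} {z} {s = score w T} {s′ = score w T′} {s″ = score w (reverse z y T′)} (reverse-score t x<w z<w xz) (reverse-score t′ z<w y<w zy′)
  where
  T′ = reverse x z T
  z≢y = arc⇒≢ t zy
  t′ = reverse-tournament (arc⇒≢ t xz) t
  zy′ : T′ z y ≡ true
  -- The arc from `z` to `y` survives the first reversal, since neither of its ends is `x`.
  zy′ = trans (reverse-off {T = T} λ { (inj₁ (p , _)) → arc⇒≢ t xz (sym p) ; (inj₂ (_ , q)) → x≢y (sym q) }) zy

-- Landau's theorem: move units of score from the first x above its target to some y < x below its target.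
module _ {w : ℕ} {b : ℕ → ℕ} (mono : ∀ {i j} → i ≤ j → b i ≤ b j) where

  private
    -- Landau's inequalities with the current scores in place of 0, 1, 2, ..., which are those of
    -- the transitive tournament at the start.
    Majorised : (ℕ → ℕ) → Set
    Majorised s = ∀ {t} → t ≤ w → sum< t s ≤ sum< t b

    -- Each move lowers the total deficit, of which `fuel` is a strict upper bound.
    equalise : ∀ fuel T → Tournament T → Outside w T →
               Majorised (score w T) → sum< w (score w T) ≡ sum< w b →
               sum< w (λ i → b i ∸ score w T i) < fuel →
               ∃ λ T′ → Tournament T′ × Outside w T′ × (∀ {i} → i < w → score w T′ i ≡ b i)
    equalise (suc fuel) T t out maj eq (s≤s deficit) with least (λ x → b x <? score w T x) w
    -- No score exceeds its target and the sums agree, so all are equal.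
    ... | inj₂ none = T , t , out , λ {i} i<w → ≤-antisym (≮⇒≥ (none i<w))
            (≮⇒≥ λ lt → <⇒≢ (sum-mono-< w (≮⇒≥ ∘ none) i<w lt) eq)
    ... | inj₁ (x , x<w , over , min) with least (λ y → score w T y <? b y) x
    -- If no score before `x` were below its target, the prefix ending with `x` would violate
    -- majorisation.
    ...   | inj₂ none = contradiction (maj x<w) (<⇒≱ (+-mono-≤-< (sum-mono x (≮⇒≥ ∘ none)) over))
    ...   | inj₁ (y , y<x , under , _) =
      equalise fuel T′ t′ out′ maj′ (≤-antisym (maj′ ≤-refl) total′) (<-≤-trans deficit′ deficit)
      where
      s = score w T
      y<w = <-trans y<x x<w
      x≢y = ≢-sym (<⇒≢ y<x)
      -- The score of `y` is below `b y ≤ b x`, and `b x` is below the score of `x`, so `move`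
      -- applies.
      moved = move t out x<w y<w x≢y (<⇒≤ (<-trans under (≤-<-trans (mono (<⇒≤ y<x)) over)))
      T′ = proj₁ moved
      t′ = proj₁ (proj₂ moved)
      out′ = proj₁ (proj₂ (proj₂ moved))
      tr : Transfer x y s (score w T′)
      tr = proj₂ (proj₂ (proj₂ moved))
      s′ = score w T′

      prefix : ∀ t → sum< t s′ + sum< t (δ x) ≡ sum< t s + sum< t (δ y)
      prefix t = trans (sym (sum-+ t s′ (δ x))) (trans (sum-cong t (λ {i} _ → tr i)) (sum-+ t s (δ y)))

      same : ∀ t c → sum< t (δ x) ≡ c → sum< t (δ y) ≡ c → sum< t s′ ≡ sum< t s
      same t c p q = +-cancelʳ-≡ c _ _ (subst₂ (λ c d → sum< t s′ + c ≡ sum< t s + d) p q (prefix t))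

      total′ : sum< w b ≤ sum< w s′
      total′ = ≤-reflexive (sym (trans (same w 1 (sum-δ-> w x<w) (sum-δ-> w y<w)) eq))

      maj′ : Majorised s′
      maj′ {t} t≤w with y <? t | x <? t
      ... | _       | yes x<t = subst (_≤ _) (sym (same t 1 (sum-δ-> t x<t) (sum-δ-> t (<-trans y<x x<t)))) (maj t≤w)
      ... | no y≮t  | no x≮t  = subst (_≤ _) (sym (same t 0 (sum-δ-≤ t (≮⇒≥ x≮t)) (sum-δ-≤ t (≮⇒≥ y≮t)))) (maj t≤w)
      -- Only prefixes that contain `y` but not `x` grow, and by one. There is room: `x` is the
      -- first vertex above its target, so no term is above its target, and `y` is strictly below.
      ... | yes y<t | no x≮t  = subst (_≤ sum< t b) (sym one-more)
              (sum-mono-< t (λ i<t → ≮⇒≥ (min (<-≤-trans i<t (≮⇒≥ x≮t)))) y<t under)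
        where
        one-more : sum< t s′ ≡ suc (sum< t s)
        one-more = trans (sym (+-identityʳ _)) (trans
          (subst₂ (λ c d → sum< t s′ + c ≡ sum< t s + d) (sum-δ-≤ t (≮⇒≥ x≮t)) (sum-δ-> t y<t) (prefix t))
          (+-comm _ 1))

      s′y : s′ y ≡ suc (s y)
      s′y = trans (sym (+-identityʳ _)) (trans
        (subst₂ (λ c d → s′ y + c ≡ s y + d) (δ-≢ x≢y) (δ-≡ y) (tr y)) (+-comm _ 1))

      deficit′ : sum< w (λ i → b i ∸ s′ i) < sum< w (λ i → b i ∸ s i)
      deficit′ = sum-mono-< w (λ {i} _ → pointwise i) y<w
        (subst (λ c → b y ∸ c < b y ∸ s y) (sym s′y) (∸-monoʳ-< (n<1+n (s y)) under))
        where
        pointwise : ∀ i → b i ∸ s′ i ≤ b i ∸ s i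
        pointwise i with x ≟ i
        ... | no x≢i = ∸-monoʳ-≤ (b i) (≤-trans (m≤m+n (s i) _)
              (≤-reflexive (trans (sym (tr i)) (trans (cong (s′ i +_) (δ-≢ x≢i)) (+-identityʳ _)))))
        -- The score of `x` was above its target and drops by one only, so the deficit at `x`
        -- remains zero.
        ... | yes refl = subst (_≤ b x ∸ s x) (sym (m≤n⇒m∸n≡0 b≤s′)) z≤n
          where
          s≡1+s′ : s x ≡ suc (s′ x)
          s≡1+s′ = trans (sym (+-identityʳ _)) (trans
            (sym (subst₂ (λ c d → s′ x + c ≡ s x + d) (δ-≡ x) (δ-≢ (≢-sym x≢y)) (tr x))) (+-comm _ 1))
          b≤s′ : b x ≤ s′ x
          b≤s′ = m<1+n⇒m≤n (subst (b x <_) s≡1+s′ over)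

  private
    transitive : ℕ → ℕ → Bool
    transitive x y = does (y <? x)

    transitive-tournament : Tournament transitive
    transitive-tournament .irrefl x = dec-false (x <? x) (<-irrefl refl)
    transitive-tournament .anti {x} {y} x≢y with y <? x
    ... | yes y<x = trans (dec-false (x <? y) (<⇒≯ y<x)) (cong not (sym (dec-true (y <? x) y<x)))
    ... | no  y≮x = trans (dec-true (x <? y) (≤∧≢⇒< (≮⇒≥ y≮x) x≢y)) (cong not (sym (dec-false (y <? x) y≮x)))

    transitive-score : ∀ {x} t → x ≤ t → score t transitive x ≡ x
    transitive-score {x} t x≤t = trans (sum-extend t _ x≤t outside) (trans (sum-cong x inside) ones)
      where
      outside : ∀ {i} → x ≤ i → bit (transitive x i) ≡ 0
      outside {i} x≤i = cong bit (dec-false (i <? x) (≤⇒≯ x≤i))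
      inside : ∀ {i} → i < x → bit (transitive x i) ≡ 1
      inside {i} i<x = cong bit (dec-true (i <? x) i<x)
      ones : sum< x (λ _ → 1) ≡ x
      ones = trans (sum-const x 1) (*-identityʳ x)

  landau : (∀ {t} → t ≤ w → sum< t (λ i → i) ≤ sum< t b) → sum< w (λ i → i) ≡ sum< w b →
           ∃ λ T → Tournament T × Outside w T × (∀ {i} → i < w → score w T i ≡ b i)
  landau maj eq = equalise _ transitive transitive-tournament (λ _ → refl)
    (λ {t} t≤w → subst (_≤ sum< t b) (sym (initial t≤w)) (maj t≤w)) (trans (initial ≤-refl) eq) (n<1+n _)
    where
    initial : ∀ {t} → t ≤ w → sum< t (score w transitive) ≡ sum< t (λ i → i)
    initial {t} t≤w = sum-cong t λ {i} i<t → transitive-score {i} w (<⇒≤ (<-≤-trans i<t t≤w))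

-- Balanced scores satisfying Landau's condition

sum-id : ∀ t → 2 * (sum< t (λ i → i) + t) ≡ t * suc t
sum-id zero    = refl
sum-id (suc t) = trans (step (sum< t (λ i → i)) t) (trans (cong (_+ (t + t + 2)) (sum-id t)) (square t))
  where
  step : ∀ s t → 2 * (s + t + suc t) ≡ 2 * (s + t) + (t + t + 2)
  step = solve-∀
  square : ∀ t → t * suc t + (t + t + 2) ≡ suc t * suc (suc t)
  square = solve-∀

-- Here `a + r` is `v - 1`: `a` vertices are to be centres of `q` stars and `r` vertices of `suc q`.
-- The equation says that these stars have as many edges as the complete graph on `v` vertices.
module _ (k q a r : ℕ) .{{_ : NonZero k}} (2k≤w : 2 * k ≤ a + r)
         (eq : (a + r) * suc (a + r) ≡ 2 * k * (q * (a + r) + r)) where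

  private
    w = a + r

    instance
      w-nonZero : NonZero w
      w-nonZero = >-nonZero (<-≤-trans (*-monoʳ-< 2 (>-nonZero⁻¹ k)) 2k≤w)

    -- Bounding `2 * k` by `w` in the term with `r` of the edge count and cancelling `w`. It yields
    -- Landau's inequalities for prefixes of length at most `a`.
    low : suc a ≤ 2 * k * q
    low = *-cancelˡ-≤ w (+-cancelʳ-≤ (2 * k * r) _ _ (begin
      w * suc a + 2 * k * r  ≤⟨ +-monoʳ-≤ (w * suc a) (*-monoˡ-≤ r 2k≤w) ⟩
      w * suc a + w * r      ≡⟨ e₁ a r ⟩
      w * suc w              ≡⟨ eq ⟩
      2 * k * (q * w + r)    ≡⟨ e₂ (2 * k) q w r ⟩
      w * (2 * k * q) + 2 * k * r ∎))
      where
      open ≤-Reasoning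
      e₁ : ∀ a r → (a + r) * suc a + (a + r) * r ≡ (a + r) * suc (a + r)
      e₁ = solve-∀
      e₂ : ∀ K q w r → K * (q * w + r) ≡ w * (K * q) + K * r
      e₂ = solve-∀

    -- The same count with every vertex raised to `suc q` stars, where the surplus `2 * k * a` is at
    -- most `w * a`. It bounds what a vertex of the upper group adds to the weighted sum.
    high : 2 * k * suc q ≤ suc (w + a)
    high = *-cancelˡ-≤ w (+-cancelʳ-≤ (2 * k * r) _ _ (begin
      w * (2 * k * suc q) + 2 * k * r        ≡⟨ e₁ (2 * k) q a r ⟩
      2 * k * (q * w + r) + 2 * k * a + 2 * k * r ≡⟨ cong (λ s → s + 2 * k * a + 2 * k * r) eq ⟨
      w * suc w + 2 * k * a + 2 * k * r      ≤⟨ +-monoˡ-≤ (2 * k * r) (+-monoʳ-≤ (w * suc w) (*-monoˡ-≤ a 2k≤w)) ⟩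
      w * suc w + w * a + 2 * k * r          ≡⟨ cong (_+ 2 * k * r) (e₂ w a) ⟩
      w * suc (w + a) + 2 * k * r            ∎))
      where
      open ≤-Reasoning
      e₁ : ∀ K q a r → (a + r) * (K * suc q) + K * r ≡ K * (q * (a + r) + r) + K * a + K * r
      e₁ = solve-∀
      e₂ : ∀ w a → w * suc w + w * a ≡ w * suc (w + a)
      e₂ = solve-∀

  -- The number of stars centred at `i`. The smaller value comes first, so that the scores are
  -- monotone and vertex 0 has the least one.
  multiplicity : ℕ → ℕ
  multiplicity i = if does (i <? a) then q else suc q

  multiplicity-low : ∀ {i} → i < a → multiplicity i ≡ q
  multiplicity-low {i} i<a = cong (if_then q else suc q) (dec-true (i <? a) i<a)

  multiplicity-high : ∀ {i} → a ≤ i → multiplicity i ≡ suc q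
  multiplicity-high {i} a≤i = cong (if_then q else suc q) (dec-false (i <? a) (≤⇒≯ a≤i))

  multiplicity-mono : ∀ {i j} → i ≤ j → multiplicity i ≤ multiplicity j
  multiplicity-mono {i} {j} i≤j with <-≤-connex i a | <-≤-connex j a
  ... | inj₁ i<a | inj₁ j<a rewrite multiplicity-low i<a | multiplicity-low j<a = ≤-refl
  ... | inj₁ i<a | inj₂ a≤j rewrite multiplicity-low i<a | multiplicity-high a≤j = n≤1+n q
  ... | inj₂ a≤i | _ rewrite multiplicity-high a≤i | multiplicity-high (≤-trans a≤i i≤j) = ≤-refl

  multiplicity-positive : ∀ i → 0 < multiplicity i
  multiplicity-positive i = ≤-trans (0<q low) q≤
    where
    0<q : ∀ {q} → suc a ≤ 2 * k * q → 0 < q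
    0<q {zero}  le with () ← subst (suc a ≤_) (*-zeroʳ (2 * k)) le
    0<q {suc q} _  = s≤s z≤n
    q≤ : q ≤ multiplicity i
    q≤ with <-≤-connex i a
    ... | inj₁ i<a = ≤-reflexive (sym (multiplicity-low i<a))
    ... | inj₂ a≤i = ≤-trans (n≤1+n q) (≤-reflexive (sym (multiplicity-high a≤i)))

  private
    sum-low : ∀ t → t ≤ a → sum< t multiplicity ≡ q * t
    sum-low t t≤a = trans (sum-cong t (λ i<t → multiplicity-low (<-≤-trans i<t t≤a)))
                          (trans (sum-const t q) (*-comm t q))

    sum-high : ∀ u → sum< (a + u) multiplicity ≡ q * (a + u) + u
    sum-high zero = trans (cong (λ t → sum< t multiplicity) (+-identityʳ a))
      (trans (sum-low a ≤-refl) (sym (trans (+-identityʳ _) (cong (q *_) (+-identityʳ a)))))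
    sum-high (suc u) rewrite +-suc a u =
      trans (cong₂ _+_ (sum-high u) (multiplicity-high (m≤m+n a u))) (lemma q (a + u) u)
      where
      lemma : ∀ q t u → q * t + u + suc q ≡ q * suc t + suc u
      lemma = solve-∀

    -- Up to `a`, each vertex contributes `2 * k * q`, at least `t + 1` by `low`. Beyond `a`, the
    -- argument descends from equality at `w`: omitting `e` upper vertices lowers the left side by
    -- `e * (w + t + 1)`, and by `high` the right side by no more.
    majorised : ∀ {t} → t ≤ w → t * suc t ≤ 2 * k * sum< t multiplicity
    majorised {t} t≤w with ≤-total t a
    ... | inj₁ t≤a rewrite sum-low t t≤a = begin
      t * suc t        ≤⟨ *-monoʳ-≤ t (≤-trans (s≤s t≤a) low) ⟩
      t * (2 * k * q)  ≡⟨ lemma t (2 * k) q ⟩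
      2 * k * (q * t)  ∎
      where
      open ≤-Reasoning
      lemma : ∀ t K q → t * (K * q) ≡ K * (q * t)
      lemma = solve-∀
    ... | inj₂ a≤t with m≤n⇒∃[o]m+o≡n a≤t
    ...   | (u , refl) with m≤n⇒∃[o]m+o≡n (+-cancelˡ-≤ a u r t≤w)
    ...     | (e , refl) rewrite sum-high u = +-cancelʳ-≤ (e * suc (a + (u + e) + (a + u))) _ _ (begin
      (a + u) * suc (a + u) + e * suc (a + (u + e) + (a + u))  ≡⟨ e₁ a u e ⟩
      (a + (u + e)) * suc (a + (u + e))                        ≡⟨ eq ⟩
      2 * k * (q * (a + (u + e)) + (u + e))                    ≡⟨ e₂ (2 * k) q a u e ⟩
      2 * k * (q * (a + u) + u) + e * (2 * k * suc q)          ≤⟨ +-monoʳ-≤ _ (*-monoʳ-≤ e high′) ⟩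
      2 * k * (q * (a + u) + u) + e * suc (a + (u + e) + (a + u)) ∎)
      where
      open ≤-Reasoning
      high′ : 2 * k * suc q ≤ suc (a + (u + e) + (a + u))
      high′ = ≤-trans high (s≤s (+-monoʳ-≤ (a + (u + e)) (m≤m+n a u)))
      e₁ : ∀ a u e → (a + u) * suc (a + u) + e * suc (a + (u + e) + (a + u)) ≡ (a + (u + e)) * suc (a + (u + e))
      e₁ = solve-∀
      e₂ : ∀ K q a u e → K * (q * (a + (u + e)) + (u + e)) ≡ K * (q * (a + u) + u) + e * (K * suc q)
      e₂ = solve-∀

    -- One less than a multiple of `k`: the missing arc will go to the common out-neighbour.
    target : ℕ → ℕ
    target i = pred (k * multiplicity i)

    suc-target : ∀ i → target i + 1 ≡ k * multiplicity i
    suc-target i = trans (+-comm _ 1) (suc-pred _ {{m*n≢0 k _ {{>-nonZero (>-nonZero⁻¹ k)}} {{>-nonZero (multiplicity-positive i)}}}})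

    sum-target : ∀ t → sum< t target + t ≡ k * sum< t multiplicity
    sum-target t = trans (cong (sum< t target +_) (trans (sym (*-identityʳ t)) (sym (sum-const t 1))))
      (trans (sym (sum-+ t target (λ _ → 1))) (trans (sum-cong t (λ {i} _ → suc-target i)) (sum-* t k multiplicity)))

    doubled : ∀ t → 2 * (sum< t target + t) ≡ 2 * k * sum< t multiplicity
    doubled t = trans (cong (2 *_) (sum-target t)) (sym (*-assoc 2 k _))

  balanced-tournament : ∃ λ T → Tournament T × Outside w T ×
                        (∀ {i} → i < w → score w T i + 1 ≡ k * multiplicity i)
  balanced-tournament with landau {w} {target} (pred-mono-≤ ∘ *-monoʳ-≤ k ∘ multiplicity-mono)
      (λ {t} t≤w → +-cancelʳ-≤ t _ _ (*-cancelˡ-≤ 2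
         (subst₂ _≤_ (sym (sum-id t)) (sym (doubled t)) (majorised t≤w))))
      (+-cancelʳ-≡ w _ _ (*-cancelˡ-≡ _ _ 2 (begin
         2 * (sum< w (λ i → i) + w)   ≡⟨ sum-id w ⟩
         w * suc w                    ≡⟨ eq ⟩
         2 * k * (q * w + r)          ≡⟨ cong (2 * k *_) (sum-high r) ⟨
         2 * k * sum< w multiplicity  ≡⟨ doubled w ⟨
         2 * (sum< w target + w)      ∎)))
    where open ≡-Reasoning
  ... | T , t , out , scores = T , t , out , λ {i} i<w → trans (cong (_+ 1) (scores i<w)) (suc-target i)

-- Parity correction

parity : ∀ s → 2 ∣ s ⊎ 2 ∣ suc s
parity zero = inj₁ (2 ∣0)
parity (suc s) with parity s
... | inj₂ odd  = inj₁ odd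
... | inj₁ even = inj₂ (∣m∣n⇒∣m+n ∣-refl even)

-- The matrix of `T`, its transpose and the identity matrix add up to the all-ones matrix.
total-score : ∀ n {T} → Tournament T → 2 * sum< n (score n T) + n ≡ n * n
total-score n {T} t = begin
  2 * sum< n (score n T) + n ≡⟨ cong (_+ n) (cong (S +_) (+-identityʳ S)) ⟩
  S + S + n
    ≡⟨ cong₂ _+_ (cong (S +_) (sum-swap n n (λ x y → bit (T x y)))) ones ⟩
  S + sum< n (λ x → sum< n (λ y → bit (T y x))) + sum< n (λ x → sum< n (δ x))
    ≡⟨ cong (_+ sum< n (λ x → sum< n (δ x))) (sum-+ n (score n T) (λ x → sum< n (λ y → bit (T y x)))) ⟨
  sum< n (λ x → score n T x + sum< n (λ y → bit (T y x))) + sum< n (λ x → sum< n (δ x))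
    ≡⟨ sum-+ n (λ x → score n T x + sum< n (λ y → bit (T y x))) (λ x → sum< n (δ x)) ⟨
  sum< n (λ x → score n T x + sum< n (λ y → bit (T y x)) + sum< n (δ x))
    ≡⟨ sum-cong n (λ {x} _ → row x) ⟩
  sum< n (λ _ → n)
    ≡⟨ sum-const n n ⟩
  n * n ∎
  where
  open ≡-Reasoning
  S = sum< n (score n T)

  ones : n ≡ sum< n (λ x → sum< n (δ x))
  ones = sym (trans (sum-cong n (sum-δ-> n)) (trans (sum-const n 1) (*-identityʳ n)))

  one : ∀ x y → bit (T x y) + bit (T y x) + δ x y ≡ 1
  one x y with x ≟ y
  ... | yes refl rewrite irrefl t x | δ-≡ x = refl
  ... | no x≢y rewrite anti t x≢y | δ-≢ x≢y = trans (+-identityʳ _) (bit-not (T x y))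

  row : ∀ x → score n T x + sum< n (λ y → bit (T y x)) + sum< n (δ x) ≡ n
  row x = trans (cong (_+ sum< n (δ x)) (sym (sum-+ n (bit ∘ T x) (λ y → bit (T y x)))))
    (trans (sym (sum-+ n (λ y → bit (T x y) + bit (T y x)) (δ x)))
    (trans (sum-cong n (λ {y} _ → one x y)) (trans (sum-const n 1) (*-identityʳ n))))

even-head : ∀ t {f : ℕ → ℕ} → (∀ {i} → i < suc t → i ≢ 0 → 2 ∣ f i) → 2 ∣ sum< (suc t) f → 2 ∣ f 0
even-head zero    even ev = ev
even-head (suc t) {f} even ev = even-head t (even ∘ m<n⇒m<1+n)
  (∣m+n∣m⇒∣n (subst (2 ∣_) (+-comm _ (f (suc t))) ev) (even ≤-refl λ ()))

-- Reversing the edge, whichever way it points, changes the score of `a` by one.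
flip-parity : ∀ {n a b T} → Tournament T → a < n → b < n → a ≢ b → 2 ∣ suc (score n T a) →
              ∃ λ T′ → Tournament T′ × (∀ {x y} → ¬ Edge a b x y → T′ x y ≡ T x y) ×
              (∀ {x} → x ≢ a → x ≢ b → score n T′ x ≡ score n T x) × 2 ∣ score n T′ a
flip-parity {n} {a} {b} {T} t a<n b<n a≢b odd with total t a≢b
... | inj₁ ab = reverse a b T , reverse-tournament a≢b t , reverse-off {T = T} ,
      (λ {x} x≢a x≢b → +-cancelʳ-≡ 0 _ _ (subst₂ (λ c d → score n (reverse a b T) x + c ≡ score n T x + d)
          (δ-≢ (≢-sym x≢a)) (δ-≢ (≢-sym x≢b)) (tr x))) ,
      ∣m+n∣m⇒∣n {m = 2} (subst (2 ∣_) (cong suc (trans (sym (+-identityʳ _)) (trans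
          (sym (subst₂ (λ c d → score n (reverse a b T) a + c ≡ score n T a + d) (δ-≡ a) (δ-≢ (≢-sym a≢b)) (tr a)))
          (+-comm _ 1)))) odd) ∣-refl
  where tr = reverse-score t a<n b<n ab
... | inj₂ ba = reverse b a T , reverse-tournament (≢-sym a≢b) t , (λ ¬e → reverse-off {T = T} (¬e ∘ Sum.swap)) ,
      (λ {x} x≢a x≢b → +-cancelʳ-≡ 0 _ _ (subst₂ (λ c d → score n (reverse b a T) x + c ≡ score n T x + d)
          (δ-≢ (≢-sym x≢b)) (δ-≢ (≢-sym x≢a)) (tr x))) ,
      subst (2 ∣_) (sym (trans (sym (+-identityʳ _)) (trans
          (subst₂ (λ c d → score n (reverse b a T) a + c ≡ score n T a + d) (δ-≢ (≢-sym a≢b)) (δ-≡ a) (tr a))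
          (+-comm _ 1)))) odd
  where tr = reverse-score t b<n a<n ba

-- Only the reserved arcs from `x` to `p x` may be reversed, so arcs chosen for the P₃s inside stars
-- will survive.
Keeps : (T : ℕ → ℕ → Bool) (p : ℕ → ℕ) (T′ : ℕ → ℕ → Bool) → Set
Keeps T p T′ = ∀ {x y} → T x y ≡ true → y ≢ p x → T′ x y ≡ true

module _ {n : ℕ} {T : ℕ → ℕ → Bool} {p : ℕ → ℕ} (t : Tournament T) where

  -- `E` holds the vertices already even, `D` those to be corrected. An edge from `x` in `D` to
  -- `p x` meets `E` nowhere and `D` only in `x`, so no correction spoils another.
  settle : ∀ {E D : ℕ → Set} → Decidable D →
           (∀ {x} → D x → ¬ E x × ¬ E (p x) × ¬ D (p x) × p x < n × T x (p x) ≡ true) →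
           ∀ {T₀} → Tournament T₀ → Keeps T p T₀ → (∀ {x} → E x → 2 ∣ score n T₀ x) →
           ∀ m → m ≤ n → ∃ λ T′ → Tournament T′ × Keeps T p T′ ×
           (∀ {x} → E x ⊎ (D x × x < m) → 2 ∣ score n T′ x)
  settle D? sep {T₀} t₀ keep even zero _ =
    T₀ , t₀ , keep , λ { (inj₁ ex) → even ex ; (inj₂ (_ , ())) }
  settle {E} {D} D? sep t₀ keep even (suc m) m<n with settle D? sep t₀ keep even m (<⇒≤ m<n)
  ... | T′ , t′ , keep′ , even′ = go (D? m) (parity (score n T′ m))
    where
    Goal = ∃ λ T′ → Tournament T′ × Keeps T p T′ × (∀ {x} → E x ⊎ (D x × x < suc m) → 2 ∣ score n T′ x)

    unchanged : (D m → 2 ∣ score n T′ m) → Goal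
    unchanged ev = T′ , t′ , keep′ , λ where
      (inj₁ ex) → even′ (inj₁ ex)
      (inj₂ (dx , x<1+m)) → [ (λ x<m → even′ (inj₂ (dx , x<m))) , (λ { refl → ev dx }) ] (m<1+n⇒m<n∨m≡n x<1+m)

    go : Dec (D m) → 2 ∣ score n T′ m ⊎ 2 ∣ suc (score n T′ m) → Goal
    go (no ¬dm) _          = unchanged (λ dm → contradiction dm ¬dm)
    go (yes _)  (inj₁ ev)  = unchanged (λ _ → ev)
    go (yes dm) (inj₂ odd) with sep dm
    ... | ¬em , ¬epm , ¬dpm , pm<n , m→pm with flip-parity t′ m<n pm<n (arc⇒≢ t m→pm) odd
    ...   | T″ , t″ , off , same , ev = T″ , t″ , keep″ , even″
      where
      keep″ : Keeps T p T″
      keep″ {x} {y} xy y≢px = trans (off away) (keep′ xy y≢px)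
        where
        away : ¬ Edge m (p m) x y
        away (inj₁ (refl , y≡pm)) = y≢px y≡pm
        -- The edge read backwards is no arc of `T`, since `T` directs it from `m` to `p m`.
        away (inj₂ (refl , refl)) = contradiction (trans (sym xy) (asym t m→pm)) λ ()

      kept-even : ∀ {x} → x ≢ m → x ≢ p m → 2 ∣ score n T′ x → 2 ∣ score n T″ x
      kept-even x≢m x≢pm = subst (2 ∣_) (sym (same x≢m x≢pm))

      even″ : ∀ {x} → E x ⊎ (D x × x < suc m) → 2 ∣ score n T″ x
      even″ (inj₁ ex) = kept-even (λ { refl → ¬em ex }) (λ { refl → ¬epm ex }) (even′ (inj₁ ex))
      even″ (inj₂ (dx , x<1+m)) with m<1+n⇒m<n∨m≡n x<1+m
      ... | inj₂ refl = ev
      ... | inj₁ x<m  = kept-even (<⇒≢ x<m) (λ { refl → ¬dpm dx }) (even′ (inj₂ (dx , x<m)))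

-- Every vertex other than the root 0 reaches it along at most two parent arcs. Reversing parent arcs,
-- deepest first, corrects the parity everywhere but at the root, whose parity follows from that of the sum.
Parents : ℕ → (ℕ → ℕ → Bool) → (ℕ → ℕ) → Set
Parents n T p = ∀ {x} → x < n → x ≢ 0 →
  (T x 0 ≡ true × p x ≡ 0) ⊎ (T x 0 ≡ false × T x (p x) ≡ true × T (p x) 0 ≡ true × p x < n)

even-tournament : ∀ {n T p} (t : Tournament T) → Parents n T p → 0 < n → 4 ∣ n * pred n →
  ∃ λ T′ → Tournament T′ × Keeps T p T′ × (∀ {x} → x < n → 2 ∣ score n T′ x)
even-tournament {suc n′} {T} {p} t parents _ 4∣ = T₂ , t₂ , keep₂ , even₂
  where
  n = suc n′

  Deep Shallow : ℕ → Set
  Deep x    = x < n × x ≢ 0 × T x 0 ≡ false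
  Shallow x = x < n × T x 0 ≡ true

  sep₁ : ∀ {x} → Deep x → ¬ ⊥ × ¬ ⊥ × ¬ Deep (p x) × p x < n × T x (p x) ≡ true
  sep₁ (x<n , x≢0 , ¬x→0) with parents x<n x≢0
  ... | inj₁ (x→0 , _) with () ← trans (sym x→0) ¬x→0
  ... | inj₂ (_ , x→p , p→0 , p<n) = (λ ()) , (λ ()) , (λ (_ , _ , ¬p→0) → contradiction (trans (sym p→0) ¬p→0) λ ()) , p<n , x→p

  sep₂ : ∀ {x} → Shallow x → ¬ Deep x × ¬ Deep (p x) × ¬ Shallow (p x) × p x < n × T x (p x) ≡ true
  sep₂ {x} (x<n , x→0) with parents x<n (arc⇒≢ t x→0)
  ... | inj₂ (¬x→0 , _) with () ← trans (sym x→0) ¬x→0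
  ... | inj₁ (_ , px≡0) rewrite px≡0 =
    (λ (_ , _ , ¬x→0) → contradiction (trans (sym x→0) ¬x→0) λ ()) , (λ (_ , 0≢0 , _) → 0≢0 refl) ,
    (λ (_ , 0→0) → arc⇒≢ t 0→0 refl) , s≤s z≤n , x→0

  stage₁ = settle {n} {T} {p} t {λ _ → ⊥} {Deep} (λ x → (x <? n) ×-dec ¬? (x ≟ 0) ×-dec (T x 0 ≟ᵇ false))
    sep₁ t (λ xy _ → xy) (λ ()) n ≤-refl
  -- The edges used now join shallow vertices to the root, so deep vertices stay even.
  stage₂ = settle {n} {T} {p} t {Deep} {Shallow} (λ x → (x <? n) ×-dec (T x 0 ≟ᵇ true)) sep₂
    (proj₁ (proj₂ stage₁)) (proj₁ (proj₂ (proj₂ stage₁)))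
    (λ deep → proj₂ (proj₂ (proj₂ stage₁)) (inj₂ (deep , proj₁ deep))) n ≤-refl

  T₂ = proj₁ stage₂
  t₂ = proj₁ (proj₂ stage₂)
  keep₂ : Keeps T p T₂
  keep₂ = proj₁ (proj₂ (proj₂ stage₂))

  non-root : ∀ {x} → x < n → x ≢ 0 → 2 ∣ score n T₂ x
  non-root {x} x<n x≢0 = proj₂ (proj₂ (proj₂ stage₂)) (by-depth (parents x<n x≢0))
    where
    by-depth : _ → Deep x ⊎ (Shallow x × x < n)
    by-depth (inj₁ (x→0 , _))  = inj₂ ((x<n , x→0) , x<n)
    by-depth (inj₂ (¬x→0 , _)) = inj₁ (x<n , x≢0 , ¬x→0)

  twice-total : 2 * sum< n (score n T₂) ≡ n * n′
  twice-total = +-cancelʳ-≡ n _ _ (trans (total-score n t₂) (trans (*-suc n n′) (+-comm n (n * n′))))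

  even₂ : ∀ {x} → x < n → 2 ∣ score n T₂ x
  -- Twice the sum of all scores is `n * n′`, divisible by 4, so the sum is even; all its other
  -- terms are even.
  even₂ {zero}  _   = even-head n′ non-root (*-cancelˡ-∣ 2 (subst (4 ∣_) (sym twice-total) 4∣))
  even₂ {suc x} x<n = non-root x<n λ ()

-- Arranging finite sets in rectangular arrays, whose rows will be the leaf sets of stars.

Arranged : (ℕ → Set) → ℕ → ℕ → Set
Arranged P m b = Σ (Fin m → Fin b → ℕ) λ f →
  (∀ {i j i′ j′} → f i j ≡ f i′ j′ → i ≡ i′ × j ≡ j′) ×
  (∀ i j → P (f i j)) × (∀ {y} → P y → ∃₂ λ i j → f i j ≡ y)

record Enumeration (P : ℕ → Set) (c : ℕ) : Set where
  field
    at       : Fin c → ℕ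
    at-inj   : ∀ {i j} → at i ≡ at j → i ≡ j
    sound    : ∀ i → P (at i)
    complete : ∀ {y} → P y → ∃ λ i → at i ≡ y

enumerate : ∀ t (f : ℕ → Bool) → Enumeration (λ y → y < t × f y ≡ true) (count t f)
enumerate zero f = record { at = λ () ; at-inj = λ { {()} } ; sound = λ () ; complete = λ () }
enumerate (suc t) f with enumerate t f | f t in ft
... | E | false = subst (Enumeration _) (sym (+-identityʳ _)) record
  { at       = E.at
  ; at-inj   = E.at-inj
  ; sound    = λ i → m<n⇒m<1+n (proj₁ (E.sound i)) , proj₂ (E.sound i)
  ; complete = complete }
  where
  module E = Enumeration E
  complete : ∀ {y} → y < suc t × f y ≡ true → ∃ λ i → E.at i ≡ y
  complete (y<1+t , fy) with m<1+n⇒m<n∨m≡n y<1+t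
  ... | inj₁ y<t  = E.complete (y<t , fy)
  ... | inj₂ refl = contradiction (trans (sym fy) ft) λ ()
... | E | true = subst (Enumeration _) (+-comm 1 _) record
  { at = at ; at-inj = at-inj ; sound = sound ; complete = complete }
  where
  module E = Enumeration E
  at : Fin (suc (count t f)) → ℕ
  at zero    = t
  at (suc i) = E.at i
  below : ∀ i → E.at i ≢ t
  below i = <⇒≢ (proj₁ (E.sound i))
  at-inj : ∀ {i j} → at i ≡ at j → i ≡ j
  at-inj {zero}  {zero}  _  = refl
  at-inj {zero}  {suc j} eq = contradiction (sym eq) (below j)
  at-inj {suc i} {zero}  eq = contradiction eq (below i)
  at-inj {suc i} {suc j} eq = cong suc (E.at-inj eq)
  sound : ∀ i → at i < suc t × f (at i) ≡ true
  sound zero    = n<1+n t , ft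
  sound (suc i) = m<n⇒m<1+n (proj₁ (E.sound i)) , proj₂ (E.sound i)
  complete : ∀ {y} → y < suc t × f y ≡ true → ∃ λ i → at i ≡ y
  complete (y<1+t , fy) with m<1+n⇒m<n∨m≡n y<1+t
  ... | inj₂ refl = zero , refl
  ... | inj₁ y<t  = let i , eq = E.complete (y<t , fy) in suc i , eq

arrange : ∀ {P} m b → Enumeration P (m * b) → Arranged P m b
arrange m b E = (λ i j → at (combine i j)) , (λ eq → combine-injective _ _ _ _ (at-inj eq)) ,
  (λ i j → sound _) , λ py → let i , eq = complete py in
    proj₁ (remQuot {m} b i) , proj₂ (remQuot {m} b i) , trans (cong at (combine-remQuot {m} b i)) eq
  where open Enumeration E

Disjoint : (P Q : ℕ → Set) → Set
Disjoint P Q = ∀ {y} → P y → ¬ Q y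

-- For widening each P₃ at a vertex to a whole star.
beside : ∀ {P Q m b c} → Disjoint P Q → Arranged P m b → Arranged Q m c → Arranged (P ∪ Q) m (b + c)
beside {P} {Q} {m} {b} {c} dis (f , f-inj , f-sound , f-complete) (g , g-inj , g-sound , g-complete) =
  h , inj , sound , complete
  where
  h : Fin m → Fin (b + c) → ℕ
  h i j = [ f i , g i ] (splitAt b j)
  inj : ∀ {i j i′ j′} → h i j ≡ h i′ j′ → i ≡ i′ × j ≡ j′
  inj {i} {j} {i′} {j′} eq with splitAt b j in p | splitAt b j′ in q
  ... | inj₁ k | inj₁ k′ = let r , s = f-inj eq in r , trans (sym (splitAt⁻¹-↑ˡ p)) (trans (cong (_↑ˡ c) s) (splitAt⁻¹-↑ˡ q))
  ... | inj₁ k | inj₂ k′ = contradiction (subst Q (sym eq) (g-sound i′ k′)) (dis (f-sound i k))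
  ... | inj₂ k | inj₁ k′ = contradiction (subst Q eq (g-sound i k)) (dis (f-sound i′ k′))
  ... | inj₂ k | inj₂ k′ = let r , s = g-inj eq in r , trans (sym (splitAt⁻¹-↑ʳ p)) (trans (cong (b ↑ʳ_) s) (splitAt⁻¹-↑ʳ q))
  sound : ∀ i j → (P ∪ Q) (h i j)
  sound i j with splitAt b j
  ... | inj₁ k = inj₁ (f-sound i k)
  ... | inj₂ k = inj₂ (g-sound i k)
  complete : ∀ {y} → (P ∪ Q) y → ∃₂ λ i j → h i j ≡ y
  complete (inj₁ py) = let i , j , eq = f-complete py in
    i , j ↑ˡ c , trans (cong [ f i , g i ] (splitAt-↑ˡ b j c)) eq
  complete (inj₂ qy) = let i , j , eq = g-complete qy in
    i , b ↑ʳ j , trans (cong [ f i , g i ] (splitAt-↑ʳ b c j)) eq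

-- For adding the P₃s that lie in no prescribed star.
above : ∀ {P Q m n b} → Disjoint P Q → Arranged P m b → Arranged Q n b → Arranged (P ∪ Q) (m + n) b
above {P} {Q} {m} {n} {b} dis (f , f-inj , f-sound , f-complete) (g , g-inj , g-sound , g-complete) =
  h , inj , sound , complete
  where
  h : Fin (m + n) → Fin b → ℕ
  h i j = [ (λ k → f k j) , (λ k → g k j) ] (splitAt m i)
  inj : ∀ {i j i′ j′} → h i j ≡ h i′ j′ → i ≡ i′ × j ≡ j′
  inj {i} {j} {i′} {j′} eq with splitAt m i in p | splitAt m i′ in q
  ... | inj₁ k | inj₁ k′ = let r , s = f-inj eq in trans (sym (splitAt⁻¹-↑ˡ p)) (trans (cong (_↑ˡ n) r) (splitAt⁻¹-↑ˡ q)) , s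
  ... | inj₁ k | inj₂ k′ = contradiction (subst Q (sym eq) (g-sound k′ j′)) (dis (f-sound k j))
  ... | inj₂ k | inj₁ k′ = contradiction (subst Q eq (g-sound k j)) (dis (f-sound k′ j′))
  ... | inj₂ k | inj₂ k′ = let r , s = g-inj eq in trans (sym (splitAt⁻¹-↑ʳ p)) (trans (cong (m ↑ʳ_) r) (splitAt⁻¹-↑ʳ q)) , s
  sound : ∀ i j → (P ∪ Q) (h i j)
  sound i j with splitAt m i
  ... | inj₁ k = inj₁ (f-sound k j)
  ... | inj₂ k = inj₂ (g-sound k j)
  complete : ∀ {y} → (P ∪ Q) y → ∃₂ λ i j → h i j ≡ y
  complete (inj₁ py) = let i , j , eq = f-complete py in
    i ↑ˡ n , j , trans (cong [ (λ k → f k j) , (λ k → g k j) ] (splitAt-↑ˡ m i n)) eq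
  complete (inj₂ qy) = let i , j , eq = g-complete qy in
    m ↑ʳ i , j , trans (cong [ (λ k → f k j) , (λ k → g k j) ] (splitAt-↑ʳ m n i)) eq

arranged-resp : ∀ {P Q m b} → (∀ {y} → P y → Q y) → (∀ {y} → Q y → P y) → Arranged P m b → Arranged Q m b
arranged-resp to from (f , f-inj , f-sound , f-complete) = f , f-inj , (λ i j → to (f-sound i j)) , f-complete ∘ from

-- Star decompositions from orientations

image : ∀ {l} (Γ : Graph (Fin l)) (φ : Fin l → ℕ) → (∀ {i j} → φ i ≡ φ j → i ≡ j) → Graph ℕ
image Γ φ inj = record
  { vertices   = map φ (vertices Γ)
  ; unique     = map⁺ inj (unique Γ)
  ; Adj        = λ u v → ∃₂ λ i j → Adj Γ i j × φ i ≡ u × φ j ≡ v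
  ; adj?       = λ u v → any? λ i → any? λ j → adj? Γ i j ×-dec (φ i ≟ u) ×-dec (φ j ≟ v)
  ; adj-sym    = λ (i , j , ij , p , q) → j , i , adj-sym Γ ij , q , p
  ; adj-irrefl = λ { refl (i , j , ij , p , q) → adj-irrefl Γ (inj (trans p (sym q))) ij }
  ; adj⇒∈      = λ { (i , j , ij , refl , q) → ∈-map⁺ φ (adj⇒∈ Γ ij) }
  }

image-≅ : ∀ {l} (Γ : Graph (Fin l)) (φ : Fin l → ℕ) (inj : ∀ {i j} → φ i ≡ φ j → i ≡ j) → image Γ φ inj ≅ Γ
image-≅ {l} Γ φ inj = record
  { bijection = record
    { to        = to
    ; from      = from
    ; to-cong   = λ {u} {v} eq → inj (trans (sym (φ-to u)) (trans eq (φ-to v)))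
    ; from-cong = cong φ
    ; inverse   = (λ {i} {u} eq → inj (trans (sym (φ-to u)) eq)) , (λ {u} eq → trans (cong φ eq) (sym (φ-to u)))
    }
  ; adj⇔adj = λ u v → mk⇔
      (λ { (i , j , ij , p , q) → subst₂ (Adj Γ) (inj (trans p (φ-to u))) (inj (trans q (φ-to v))) ij })
      (λ uv → _ , _ , uv , sym (φ-to u) , sym (φ-to v))
  }
  where
  to : ∃ (_∈ map φ (vertices Γ)) → ∃ (_∈ vertices Γ)
  to (u , u∈) = let i , i∈ , _ = ∈-map⁻ φ u∈ in i , i∈
  from : ∃ (_∈ vertices Γ) → ∃ (_∈ map φ (vertices Γ))
  from (i , i∈) = φ i , ∈-map⁺ φ i∈
  φ-to : ∀ u → proj₁ u ≡ φ (proj₁ (to u))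
  φ-to (u , u∈) = proj₂ (proj₂ (∈-map⁻ φ u∈))

≅-trans : ∀ {A B C : Set} {G : Graph A} {H : Graph B} {K : Graph C} → G ≅ H → H ≅ K → G ≅ K
≅-trans p q = record
  { bijection = Composition.inverse p.bijection q.bijection
  ; adj⇔adj   = λ x y → Composition.equivalence (p.adj⇔adj x y) (q.adj⇔adj (p.to x) (p.to y))
  }
  where
  module p = _≅_ p
  module q = _≅_ q

star₂≅path₃ : Star 2 ≅ Path 3
star₂≅path₃ = record
  { bijection = record
    { to        = λ (i , _) → τ i , ∈-allFin (τ i)
    ; from      = λ (i , _) → τ i , ∈-allFin (τ i)
    ; to-cong   = cong τ
    ; from-cong = cong τ
    ; inverse   = (λ { {i , _} refl → ττ i }) , (λ { {i , _} refl → ττ i })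
    }
  ; adj⇔adj = λ (i , _) (j , _) → mk⇔ (to i j) (from i j)
  }
  where
  -- The centre of the star is label 0 and the middle of the path is label 1, so these two are
  -- exchanged.
  τ : Fin 3 → Fin 3
  τ zero          = suc zero
  τ (suc zero)    = zero
  τ (suc (suc i)) = suc (suc i)
  ττ : ∀ i → τ (τ i) ≡ i
  ττ zero          = refl
  ττ (suc zero)    = refl
  ττ (suc (suc i)) = refl
  to : ∀ i j → StarAdj i j → Adj (Path 3) (τ i) (τ j)
  to zero             (suc zero)       _ = inj₂ refl
  to zero             (suc (suc zero)) _ = inj₁ refl
  to (suc zero)       zero             _ = inj₁ refl
  to (suc (suc zero)) zero             _ = inj₂ refl
  from : ∀ i j → Adj (Path 3) (τ i) (τ j) → StarAdj i j
  from zero             zero             (inj₁ ())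
  from zero             zero             (inj₂ ())
  from zero             (suc j)          _ = tt
  from (suc i)          zero             _ = tt
  from (suc zero)       (suc zero)       (inj₁ ())
  from (suc zero)       (suc zero)       (inj₂ ())
  from (suc zero)       (suc (suc zero)) (inj₁ ())
  from (suc zero)       (suc (suc zero)) (inj₂ ())
  from (suc (suc zero)) (suc zero)       (inj₁ ())
  from (suc (suc zero)) (suc zero)       (inj₂ ())
  from (suc (suc zero)) (suc (suc zero)) (inj₁ ())
  from (suc (suc zero)) (suc (suc zero)) (inj₂ ())

-- A block is addressed by its centre and its number at that centre; `locate` flattens this to a
-- single index.
Slot : (ℕ → ℕ) → Set
Slot m = Σ ℕ (Fin ∘ m)

module _ (m : ℕ → ℕ) where

  locate : ∀ n → Fin (sum< n m) → Slot m
  locate (suc n) i = [ locate n , (λ j → n , j) ]′ (splitAt (sum< n m) i)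

  locate-< : ∀ n i → proj₁ (locate n i) < n
  locate-< (suc n) i with splitAt (sum< n m) i
  ... | inj₁ j = m<n⇒m<1+n (locate-< n j)
  ... | inj₂ j = n<1+n n

  position : ∀ n (s : Slot m) → proj₁ s < n → ∃ λ i → locate n i ≡ s
  position (suc n) (x , j) x<1+n with m<1+n⇒m<n∨m≡n x<1+n
  ... | inj₁ x<n  = let i , eq = position n (x , j) x<n in
    i ↑ˡ m n , trans (cong [ locate n , (λ j → n , j) ]′ (splitAt-↑ˡ (sum< n m) i (m n))) eq
  ... | inj₂ refl = sum< n m ↑ʳ j , cong [ locate n , (λ j → n , j) ]′ (splitAt-↑ʳ (sum< n m) (m n) j)

  locate-injective : ∀ n {i j} → locate n i ≡ locate n j → i ≡ j
  locate-injective (suc n) {i} {j} eq with splitAt (sum< n m) i in p | splitAt (sum< n m) j in q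
  ... | inj₁ k | inj₁ l = trans (sym (splitAt⁻¹-↑ˡ p)) (trans (cong (_↑ˡ m n) (locate-injective n eq)) (splitAt⁻¹-↑ˡ q))
  ... | inj₁ k | inj₂ l = contradiction (cong proj₁ eq) (<⇒≢ (locate-< n k))
  ... | inj₂ k | inj₁ l = contradiction (sym (cong proj₁ eq)) (<⇒≢ (locate-< n l))
  ... | inj₂ k | inj₂ l with refl ← eq = trans (sym (splitAt⁻¹-↑ʳ p)) (splitAt⁻¹-↑ʳ q)

-- Each edge belongs to exactly one star centred at its tail, because the rows at a vertex partition
-- its out-neighbours. Rows have length `suc b`, so every star has an edge.
module StarDesign {N b : ℕ} {T : ℕ → ℕ → Bool} (t : Tournament T) (m : ℕ → ℕ)
  (blocks : ∀ {x} → x < N → Arranged (λ y → y < N × T x y ≡ true) (m x) (suc b)) where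

  leaf : ∀ {x} → x < N → Fin (m x) → Fin (suc b) → ℕ
  leaf x<N = proj₁ (blocks x<N)

  label : ∀ {x} → x < N → Fin (m x) → Fin (suc (suc b)) → ℕ
  label {x} x<N i zero    = x
  label {x} x<N i (suc j) = leaf x<N i j

  arc : ∀ {x} (x<N : x < N) i j → leaf x<N i j < N × T x (leaf x<N i j) ≡ true
  arc x<N = proj₁ (proj₂ (proj₂ (blocks x<N)))

  label-injective : ∀ {x} (x<N : x < N) i {j k} → label x<N i j ≡ label x<N i k → j ≡ k
  label-injective x<N i {zero}  {zero}  _  = refl
  label-injective x<N i {zero}  {suc k} eq = contradiction eq (arc⇒≢ t (proj₂ (arc x<N i k)))
  label-injective x<N i {suc j} {zero}  eq = contradiction (sym eq) (arc⇒≢ t (proj₂ (arc x<N i j)))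
  label-injective x<N i {suc j} {suc k} eq = cong suc (proj₂ (proj₁ (proj₂ (blocks x<N)) eq))

  star : ∀ {x} → x < N → Fin (m x) → Graph ℕ
  star x<N i = image (Star (suc b)) (label x<N i) (label-injective x<N i)

  star-≅ : ∀ {x} (x<N : x < N) i → star x<N i ≅ Star (suc b)
  star-≅ x<N i = image-≅ (Star (suc b)) (label x<N i) (label-injective x<N i)

  label-< : ∀ {x} (x<N : x < N) i j → label x<N i j < N
  label-< x<N i zero    = x<N
  label-< x<N i (suc j) = proj₁ (arc x<N i j)

  K : Graph ℕ
  K = Complete (upTo N) (upTo⁺ N)

  star≤K : ∀ {x} (x<N : x < N) i → star x<N i ≤ᴳ K
  star≤K x<N i = in-points ,
    λ { (j , k , jk , refl , refl) → ∈-upTo⁺ (label-< x<N i j) , ∈-upTo⁺ (label-< x<N i k) ,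
        λ eq → adj-irrefl (Star (suc b)) (label-injective x<N i {j} {k} eq) jk }
    where
    in-points : ∀ {u} → u ∈ vertices (star x<N i) → u ∈ upTo N
    in-points u∈ with j , _ , refl ← ∈-map⁻ (label x<N i) {xs = allFin _} u∈ = ∈-upTo⁺ (label-< x<N i j)

  OutArc : ∀ {x} → x < N → Fin (m x) → ℕ → ℕ → Set
  OutArc {x} x<N i u v = x ≡ u × ∃ λ j → leaf x<N i j ≡ v

  adj⇒arc : ∀ {x} (x<N : x < N) i {u v} → Adj (star x<N i) u v → OutArc x<N i u v ⊎ OutArc x<N i v u
  adj⇒arc x<N i (zero  , suc k , _ , p , q) = inj₁ (p , k , q)
  adj⇒arc x<N i (suc j , zero  , _ , p , q) = inj₂ (q , j , p)

  out-unique : ∀ {x y} (x<N : x < N) (y<N : y < N) {i j u v} →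
               OutArc x<N i u v → OutArc y<N j u v → _≡_ {A = Slot m} (x , i) (y , j)
  -- `leaf` depends on the proof of the bound, so the two proofs are identified before the leaves
  -- are compared.
  out-unique x<N y<N (refl , k , p) (refl , l , q) rewrite <-irrelevant x<N y<N =
    cong (_ ,_) (proj₁ (proj₁ (proj₂ (blocks y<N)) (trans p (sym q))))

  out-clash : ∀ {x y} (x<N : x < N) (y<N : y < N) {i j u v} → OutArc x<N i u v → ¬ OutArc y<N j v u
  out-clash x<N y<N (refl , k , refl) (refl , l , q)
    with () ← trans (sym (asym t (proj₂ (arc x<N _ k)))) (subst (λ z → T (leaf x<N _ k) z ≡ true) q (proj₂ (arc y<N _ l)))

  adj-unique : ∀ {x y} (x<N : x < N) (y<N : y < N) {i j u v} →
               Adj (star x<N i) u v → Adj (star y<N j) u v → _≡_ {A = Slot m} (x , i) (y , j)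
  adj-unique x<N y<N {i} {j} p q with adj⇒arc x<N i p | adj⇒arc y<N j q
  ... | inj₁ a | inj₁ c = out-unique x<N y<N a c
  ... | inj₂ a | inj₂ c = out-unique x<N y<N a c
  ... | inj₁ a | inj₂ c = ⊥-elim (out-clash x<N y<N a c)
  ... | inj₂ a | inj₁ c = ⊥-elim (out-clash x<N y<N a c)

  blockAt : Fin (sum< N m) → Graph ℕ
  blockAt i = star (locate-< m N i) (proj₂ (locate m N i))

  blockAt-unique : ∀ {i j u v} → Adj (blockAt i) u v → Adj (blockAt j) u v → i ≡ j
  blockAt-unique {i} {j} p q = locate-injective m N (adj-unique (locate-< m N i) (locate-< m N j) p q)

  blockAt-position : ∀ {x} (x<N : x < N) j → ∃ λ i → blockAt i ≡ star x<N j
  blockAt-position {x} x<N j = let i , eq = position m N (x , j) x<N in i , same i eq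
    where
    same : ∀ i → locate m N i ≡ (x , j) → blockAt i ≡ star x<N j
    same i eq with locate m N i | locate-< m N i
    same i refl | _ | <N = cong (λ <N → star <N j) (<-irrelevant <N x<N)

  covered : ∀ {u v} → u < N → v < N → T u v ≡ true → ∃ λ i → Adj (blockAt i) u v
  covered {u} {v} u<N v<N uv = let j , k , eq = proj₂ (proj₂ (proj₂ (blocks u<N))) (v<N , uv)
                                   i , eq′ = blockAt-position u<N j in
    i , subst (λ G → Adj G u v) (sym eq′) (zero , suc k , tt , refl , eq)

  cover : ∀ {u v} → Adj K u v → ∃ λ i → Adj (blockAt i) u v
  cover (u∈ , v∈ , u≢v) with total t u≢v
  ... | inj₁ uv = covered (∈-upTo⁻ u∈) (∈-upTo⁻ v∈) uv
  ... | inj₂ vu = let i , vu∈ = covered (∈-upTo⁻ v∈) (∈-upTo⁻ u∈) vu in i , adj-sym (blockAt i) vu∈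

  designOfOrder : ∀ {l} {Γ : Graph (Fin l)} → Star (suc b) ≅ Γ → DesignOfOrder N Γ
  designOfOrder iso = record
    { points = upTo N
    ; distinct-points = upTo⁺ N
    ; order = length-upTo N
    ; design = record
      { size      = sum< N m
      ; block     = blockAt
      ; block-≤   = λ i → star≤K (locate-< m N i) _
      ; block-≅   = λ i → ≅-trans (star-≅ (locate-< m N i) _) iso
      -- Equal blocks share an edge, and an edge determines its block.
      ; distinct  = λ {i} {j} i≈j → let a = edge i in blockAt-unique {i} {j} a (proj₂ (proj₁ i≈j) a)
      ; partition = λ uv → let i , a = cover uv in i , a , λ {j} c → blockAt-unique {i} {j} a c
      }
    }
    where
    edge : ∀ i → Adj (blockAt i) (proj₁ (locate m N i)) (leaf (locate-< m N i) (proj₂ (locate m N i)) zero)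
    edge i = zero , suc zero , tt , refl , refl

-- Selecting and removing subsets of prescribed size.

count-vanishing : ∀ {s t f} → s ≤ t → (∀ {y} → f y ≡ true → y < s) → count t f ≡ count s f
count-vanishing {s} {t} {f} s≤t f⇒< = sum-extend t (bit ∘ f) s≤t outside
  where
  outside : ∀ {y} → s ≤ y → bit (f y) ≡ 0
  outside {y} s≤y with f y in fy
  ... | false = refl
  ... | true  = contradiction (f⇒< fy) (≤⇒≯ s≤y)

-- The bound is lowered while at least `c` elements remain below it. One step removes at most one
-- element, so where this stops exactly `c` remain.
subcount : ∀ t f c → c ≤ count t f →
           ∃ λ g → (∀ {y} → g y ≡ true → y < t × f y ≡ true) × count t g ≡ c
subcount zero f zero z≤n = (λ _ → false) , (λ ()) , refl
subcount (suc t) f c c≤ with c ≤? count t f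
... | yes c≤count = let g , g⇒ , eq = subcount t f c c≤count in
  g , (λ gy → m<n⇒m<1+n (proj₁ (g⇒ gy)) , proj₂ (g⇒ gy)) ,
  trans (count-vanishing (n≤1+n t) (proj₁ ∘ g⇒)) eq
... | no c≰count = g , g⇒ , trans (sum-cong (suc t) λ {i} i< → cong (λ b → bit (b ∧ f i)) (dec-true (i <? suc t) i<))
                                  (≤-antisym (≤-trans all (≰⇒> c≰count)) c≤)
  where
  g : ℕ → Bool
  g y = does (y <? suc t) ∧ f y
  g⇒ : ∀ {y} → g y ≡ true → y < suc t × f y ≡ true
  g⇒ {y} gy with y <? suc t
  ... | yes y<1+t = y<1+t , trans (sym (cong (_∧ f y) (dec-true (y <? suc t) y<1+t))) gy
  ... | no  y≮1+t = contradiction (trans (sym gy) (cong (_∧ f y) (dec-false (y <? suc t) y≮1+t))) λ ()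
  all : count (suc t) f ≤ suc (count t f)
  all = ≤-trans (+-monoʳ-≤ (count t f) (bit≤1 (f t))) (≤-reflexive (+-comm _ 1))
    where
    bit≤1 : ∀ b → bit b ≤ 1
    bit≤1 true  = ≤-refl
    bit≤1 false = z≤n

infixl 6 _∖_

_∖_ : (f g : ℕ → Bool) → ℕ → Bool
(f ∖ g) y = f y ∧ not (g y)

module _ {f g : ℕ → Bool} where

  ∖-inv : ∀ {y} → (f ∖ g) y ≡ true → f y ≡ true × g y ≡ false
  ∖-inv {y} eq with f y | g y
  ... | true | false = refl , refl

  module _ (g⊆f : ∀ {y} → g y ≡ true → f y ≡ true) where

    count-∖ : ∀ t → count t g + count t (f ∖ g) ≡ count t f
    count-∖ t = trans (sym (sum-+ t (bit ∘ g) (bit ∘ (f ∖ g)))) (sum-cong t (λ {y} _ → split y))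
      where
      split : ∀ y → bit (g y) + bit ((f ∖ g) y) ≡ bit (f y)
      split y with g y in gy
      ... | true  rewrite g⊆f gy = refl
      ... | false with f y
      ...   | true  = refl
      ...   | false = refl

    module _ {s t : ℕ} (s≤t : s ≤ t) (g⇒< : ∀ {y} → g y ≡ true → y < s) where

      private
        P Q : ℕ → Set
        P y = y < s × g y ≡ true
        Q y = y < t × (f ∖ g) y ≡ true

      ∖-disjoint : Disjoint P Q
      ∖-disjoint (_ , gy) (_ , ry) = contradiction (trans (sym gy) (proj₂ (∖-inv ry))) λ ()

      ∖-∪ : ∀ {y} → (P ∪ Q) y → y < t × f y ≡ true
      ∖-∪ (inj₁ (y<s , gy)) = <-≤-trans y<s s≤t , g⊆f gy
      ∖-∪ (inj₂ (y<t , ry)) = y<t , proj₁ (∖-inv ry)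

      ∪-∖ : ∀ {y} → y < t × f y ≡ true → (P ∪ Q) y
      ∪-∖ {y} (y<t , fy) with g y in gy
      ... | true  = inj₁ (g⇒< gy , refl)
      ... | false = inj₂ (y<t , cong (_∧ true) fy)

-- Subgraphs of images, and the added common out-neighbour.

≅-refl : ∀ {A : Set} {G : Graph A} → G ≅ G
≅-refl {G = G} = record
  { bijection = Identity.inverse (Vertex G)
  ; adj⇔adj   = λ _ _ → Identity.⇔-id _
  }

image-≤ : ∀ {l l′} {Γ : Graph (Fin l)} {Γ′ : Graph (Fin l′)} {φ φ′}
          {inj : ∀ {i j} → φ i ≡ φ j → i ≡ j} {inj′ : ∀ {i j} → φ′ i ≡ φ′ j → i ≡ j}
          (ψ : Fin l → Fin l′) → (∀ i → ψ i ∈ vertices Γ′) → (∀ i j → Adj Γ i j → Adj Γ′ (ψ i) (ψ j)) →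
          (∀ i → φ′ (ψ i) ≡ φ i) → image Γ φ inj ≤ᴳ image Γ′ φ′ inj′
image-≤ {Γ = Γ} {Γ′} {φ} {φ′} ψ ψ∈ ψ-adj eq = verts , λ (i , j , ij , p , q) →
  ψ i , ψ j , ψ-adj i j ij , trans (eq i) p , trans (eq j) q
  where
  verts : ∀ {u} → u ∈ map φ (vertices Γ) → u ∈ map φ′ (vertices Γ′)
  verts u∈ with i , _ , refl ← ∈-map⁻ φ u∈ = subst (_∈ _) (eq i) (∈-map⁺ φ′ (ψ∈ i))

-- The maximum of `x` and `y` is `w` when one of them is the new vertex and the other is not larger;
-- the arc then points from the smaller to the larger, that is, to `w`.
addSink : ℕ → (ℕ → ℕ → Bool) → ℕ → ℕ → Bool
addSink w T x y = if does (x ⊔ y ≟ w) then does (x <? y) else T x y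

module _ {w : ℕ} {T : ℕ → ℕ → Bool} (t : Tournament T) where

  private
    at-sink : ∀ {x y} → x ⊔ y ≡ w → addSink w T x y ≡ does (x <? y)
    at-sink {x} {y} eq = cong (if_then does (x <? y) else T x y) (dec-true (x ⊔ y ≟ w) eq)

    off-sink : ∀ {x y} → x ⊔ y ≢ w → addSink w T x y ≡ T x y
    off-sink {x} {y} neq = cong (if_then does (x <? y) else T x y) (dec-false (x ⊔ y ≟ w) neq)

  addSink-agrees : ∀ {x y} → x < w → y < w → addSink w T x y ≡ T x y
  addSink-agrees x<w y<w = off-sink (<⇒≢ (⊔-pres-<m x<w y<w))

  addSink-tournament : Tournament (addSink w T)
  addSink-tournament .irrefl x with x ⊔ x ≟ w
  ... | yes eq = trans (at-sink {x} {x} eq) (dec-false (x <? x) (<-irrefl refl))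
  ... | no neq = trans (off-sink {x} {x} neq) (irrefl t x)
  addSink-tournament .anti {x} {y} x≢y with x ⊔ y ≟ w
  ... | no neq = trans (off-sink {y} {x} (neq ∘ trans (⊔-comm x y))) (trans (anti t x≢y) (cong not (sym (off-sink {x} {y} neq))))
  ... | yes eq = trans (at-sink {y} {x} (trans (⊔-comm y x) eq)) (trans opposite (cong not (sym (at-sink {x} {y} eq))))
    where
    opposite : does (y <? x) ≡ not (does (x <? y))
    opposite with x <? y
    ... | yes x<y = trans (dec-false (y <? x) (<⇒≯ x<y)) (cong not (sym (dec-true (x <? y) x<y)))
    ... | no  x≮y = trans (dec-true (y <? x) (≤∧≢⇒< (≮⇒≥ x≮y) (≢-sym x≢y))) (cong not (sym (dec-false (x <? y) x≮y)))

  score-addSink-< : ∀ {x} → x < w → score (suc w) (addSink w T) x ≡ score w T x + 1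
  score-addSink-< {x} x<w = cong₂ _+_ (sum-cong w (λ y<w → cong bit (addSink-agrees x<w y<w)))
    (cong bit (trans (at-sink {x} {w} (m≤n⇒m⊔n≡n (<⇒≤ x<w))) (dec-true (x <? w) x<w)))

  score-addSink-≡ : score (suc w) (addSink w T) w ≡ 0
  score-addSink-≡ = trans (sum-cong (suc w) (λ {y} y≤w → cong bit (trans (at-sink {w} {y} (m≥n⇒m⊔n≡m (≤-pred y≤w)))
    (dec-false (w <? y) (≤⇒≯ (≤-pred y≤w)))))) (trans (sum-const (suc w) 0) (*-zeroʳ (suc w)))

-- Down-linked designs from a balanced tournament.

module Construction {k′ w n : ℕ} {T : ℕ → ℕ → Bool} {mult : ℕ → ℕ} (2≤k′ : 2 ≤ k′) (0<w : 0 < w) (w≤n : w ≤ n)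
  (t : Tournament T) (out : Outside w T) (0<mult : ∀ i → 0 < mult i)
  (scores : ∀ {x} → x < w → score w T x + 1 ≡ (2 + k′) * mult x)
  (least-0 : ∀ {x} → x < w → score w T 0 ≤ score w T x)
  (4∣ : 4 ∣ n * pred n) where

  private
    -- From `w` on, `out` provides the arc to 0. Below `w`, vertex 0 has the least score, so
    -- `short-path` reaches it in at most two arcs. The value at the root itself is a default.
    parent : ∀ x → ∃ λ p → x < n → x ≢ 0 →
      (T x 0 ≡ true × p ≡ 0) ⊎ (T x 0 ≡ false × T x p ≡ true × T p 0 ≡ true × p < n)
    parent x with T x 0 in x→0 | x ≟ 0 | x <? w
    ... | true  | _        | _       = 0 , λ _ _ → inj₁ (refl , refl)
    ... | false | yes x≡0  | _       = 0 , λ _ x≢0 → contradiction x≡0 x≢0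
    ... | false | no x≢0   | no x≮w  = contradiction
      (trans (sym x→0) (trans (out (inj₁ (≮⇒≥ x≮w))) (dec-true (0 <? x) (n≢0⇒n>0 x≢0)))) λ ()
    ... | false | no x≢0   | yes x<w with short-path {w} {T} {x} {0} t x<w x≢0 (least-0 x<w)
    ...   | inj₁ x→0′ = contradiction (trans (sym x→0) x→0′) λ ()
    ...   | inj₂ (z , z<w , x→z , z→0) = z , λ _ _ → inj₂ (refl , x→z , z→0 , <-≤-trans z<w w≤n)

    p : ℕ → ℕ
    p = proj₁ ∘ parent

    -- The number of stars centred at `x`: none at the common out-neighbour `w`, nor at further
    -- points of the P₃-design.
    M : ℕ → ℕ
    M x = if does (x <? w) then mult x else 0

    M-< : ∀ {x} → x < w → M x ≡ mult x
    M-< {x} x<w = cong (if_then mult x else 0) (dec-true (x <? w) x<w)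

    M-≥ : ∀ {x} → w ≤ x → M x ≡ 0
    M-≥ {x} w≤x = cong (if_then mult x else 0) (dec-false (x <? w) (≤⇒≯ w≤x))

    free : ℕ → ℕ → Bool
    free x = T x ∖ λ y → does (p x ≟ y)

    count-free : ∀ x → score w T x ≤ count w (free x) + 1
    count-free x = begin
      score w T x                                    ≤⟨ sum-mono w (λ {y} _ → pointwise y) ⟩
      sum< w (λ y → bit (free x y) + δ (p x) y)      ≡⟨ sum-+ w (bit ∘ free x) (δ (p x)) ⟩
      count w (free x) + sum< w (δ (p x))            ≤⟨ +-monoʳ-≤ (count w (free x)) sum-δ-≤1 ⟩
      count w (free x) + 1                           ∎
      where
      open ≤-Reasoning
      pointwise : ∀ y → bit (T x y) ≤ bit (free x y) + δ (p x) y
      pointwise y with T x y | does (p x ≟ y)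
      ... | false | _     = z≤n
      ... | true  | true  = ≤-refl
      ... | true  | false = ≤-refl
      sum-δ-≤1 : sum< w (δ (p x)) ≤ 1
      sum-δ-≤1 with p x <? w
      ... | yes p<w = ≤-reflexive (sum-δ-> w p<w)
      ... | no  p≮w = ≤-trans (≤-reflexive (sum-δ-≤ w (≮⇒≥ p≮w))) z≤n

    -- With `m` stars of at least four edges at `x`, setting aside the sink and the parent leaves at
    -- least `4 * m - 2` out-neighbours, which is at least `2 * m` since `m` is positive.
    enough : ∀ x → M x * 2 ≤ count w (free x)
    enough x with <-≤-connex x w
    ... | inj₂ w≤x = ≤-trans (≤-reflexive (cong (_* 2) (M-≥ w≤x))) z≤n
    ... | inj₁ x<w = +-cancelʳ-≤ 2 _ _ (begin
      M x * 2 + 2               ≡⟨ cong (λ m → m * 2 + 2) (M-< x<w) ⟩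
      mult x * 2 + 2            ≤⟨ +-monoʳ-≤ (mult x * 2) (*-monoˡ-≤ 2 (0<mult x)) ⟩
      mult x * 2 + mult x * 2   ≡⟨ *-distribˡ-+ (mult x) 2 2 ⟨
      mult x * 4                ≤⟨ *-monoʳ-≤ (mult x) (s≤s (s≤s 2≤k′)) ⟩
      mult x * (2 + k′)         ≡⟨ *-comm (mult x) (2 + k′) ⟩
      (2 + k′) * mult x         ≡⟨ scores x<w ⟨
      score w T x + 1           ≤⟨ +-monoˡ-≤ 1 (count-free x) ⟩
      count w (free x) + 1 + 1  ≡⟨ +-assoc (count w (free x)) 1 1 ⟩
      count w (free x) + 2      ∎)
      where open ≤-Reasoning

    chosen : ∀ x → _
    chosen x = subcount w (free x) (M x * 2) (enough x)

    -- The arcs common to both designs, two for each star; they avoid the parent arcs.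
    A : ℕ → ℕ → Bool
    A x = proj₁ (chosen x)

    A⇒ : ∀ {x y} → A x y ≡ true → y < w × T x y ≡ true × y ≢ p x
    A⇒ {x} {y} xy with proj₁ (proj₂ (chosen x)) xy
    ... | y<w , fxy with ∖-inv {T x} {λ y → does (p x ≟ y)} fxy
    ...   | Txy , p≢y = y<w , Txy , λ { refl → contradiction (trans (sym p≢y) (dec-true (p x ≟ p x) refl)) λ () }

    count-A : ∀ {x N} → w ≤ N → count N (A x) ≡ M x * 2
    count-A {x} w≤N = trans (count-vanishing w≤N (proj₁ ∘ A⇒)) (proj₂ (proj₂ (chosen x)))

    pairs : ∀ x → Arranged (λ y → y < w × A x y ≡ true) (M x) 2
    pairs x = arrange (M x) 2 (subst (Enumeration _) (count-A ≤-refl) (enumerate w (A x)))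

    S : ℕ → ℕ → Bool
    S = addSink w T

    M-pos⇒< : ∀ {x} → Fin (M x) → x < w
    M-pos⇒< {x} i with <-≤-connex x w
    ... | inj₁ x<w = x<w
    ... | inj₂ w≤x with subst Fin (M-≥ w≤x) i
    ...   | ()

    A-row⇒< : ∀ {x y} → A x y ≡ true → x < w
    A-row⇒< {x} {y} xy = M-pos⇒< (proj₁ (proj₂ (proj₂ (proj₂ (pairs x))) (proj₁ (A⇒ {x} {y} xy) , xy)))

    A⊆S : ∀ {x y} → A x y ≡ true → S x y ≡ true
    A⊆S {x} {y} xy = trans (addSink-agrees t (A-row⇒< {x} {y} xy) (proj₁ (A⇒ xy))) (proj₁ (proj₂ (A⇒ xy)))

    score-S : ∀ {x} → x < suc w → score (suc w) S x ≡ M x * (2 + k′)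
    score-S {x} x<v with m<1+n⇒m<n∨m≡n x<v
    ... | inj₁ x<w  = trans (score-addSink-< t x<w) (trans (scores x<w)
                      (trans (*-comm (2 + k′) (mult x)) (cong (_* (2 + k′)) (sym (M-< x<w)))))
    ... | inj₂ refl = trans (score-addSink-≡ {w} {T} t) (cong (_* (2 + k′)) (sym (M-≥ {x} ≤-refl)))

    count-S∖A : ∀ {x} → x < suc w → count (suc w) (S x ∖ A x) ≡ M x * k′
    count-S∖A {x} x<v = +-cancelˡ-≡ (M x * 2) _ _ (begin
      M x * 2 + count (suc w) (S x ∖ A x)              ≡⟨ cong (_+ count (suc w) (S x ∖ A x)) (count-A {x} (n≤1+n w)) ⟨
      count (suc w) (A x) + count (suc w) (S x ∖ A x)  ≡⟨ count-∖ A⊆S (suc w) ⟩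
      score (suc w) S x                                ≡⟨ score-S x<v ⟩
      M x * (2 + k′)                                   ≡⟨ *-distribˡ-+ (M x) 2 k′ ⟩
      M x * 2 + M x * k′                               ∎)
      where open ≡-Reasoning

    -- The first two columns are the chosen pairs; the other `k′` leaves are distributed
    -- arbitrarily.
    starBlocks : ∀ {x} → x < suc w → Arranged (λ y → y < suc w × S x y ≡ true) (M x) (2 + k′)
    starBlocks {x} x<v = arranged-resp (∖-∪ A⊆S (n≤1+n w) (proj₁ ∘ A⇒)) (∪-∖ A⊆S (n≤1+n w) (proj₁ ∘ A⇒))
      (beside (∖-disjoint {S x} {A x} A⊆S (n≤1+n w) (proj₁ ∘ A⇒)) (pairs x)
        (arrange (M x) k′ (subst (Enumeration _) (count-S∖A x<v) (enumerate (suc w) (S x ∖ A x)))))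

    fixed = even-tournament t (λ {x} → proj₂ (parent x)) (<-≤-trans 0<w w≤n) 4∣

    O : ℕ → ℕ → Bool
    O = proj₁ fixed

    A⊆O : ∀ {x y} → A x y ≡ true → O x y ≡ true
    A⊆O xy = let _ , Txy , y≢p = A⇒ xy in proj₁ (proj₂ (proj₂ fixed)) Txy y≢p

    H : ℕ → ℕ
    H x = count n (O x ∖ A x) / 2

    count-O∖A : ∀ {x} → x < n → count n (O x ∖ A x) ≡ H x * 2
    count-O∖A {x} x<n = sym (m/n*n≡m (∣m+n∣m⇒∣n
      (subst (2 ∣_) (sym (trans (cong (_+ count n (O x ∖ A x)) (sym (count-A {x} w≤n))) (count-∖ A⊆O n)))
        (proj₂ (proj₂ (proj₂ fixed)) x<n)) (divides (M x) refl)))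

    -- The first `M x` rows are the same chosen pairs. An even number of out-neighbours is left
    -- over, as the score in `O` is even, and these fill `H x` more rows.
    pathBlocks : ∀ {x} → x < n → Arranged (λ y → y < n × O x y ≡ true) (M x + H x) 2
    pathBlocks {x} x<n = arranged-resp (∖-∪ A⊆O w≤n (proj₁ ∘ A⇒)) (∪-∖ A⊆O w≤n (proj₁ ∘ A⇒))
      (above (∖-disjoint {O x} {A x} A⊆O w≤n (proj₁ ∘ A⇒)) (pairs x)
        (arrange (H x) 2 (subst (Enumeration _) (count-O∖A x<n) (enumerate n (O x ∖ A x)))))

    module Stars = StarDesign (addSink-tournament t) M starBlocks
    module Paths = StarDesign (proj₁ (proj₂ fixed)) (λ x → M x + H x) pathBlocks

    -- Row `i` of the paths and the first two columns of row `i` of the stars are both read from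
    -- `pairs x`.
    path≤star : ∀ {x} (x<n : x < n) (x<v : x < suc w) i → Paths.star x<n (i ↑ˡ H x) ≤ᴳ Stars.star x<v i
    path≤star {x} x<n x<v i = image-≤ {Γ = Star 2} {Star (2 + k′)} {Paths.label x<n (i ↑ˡ H x)} {Stars.label x<v i} {inj = Paths.label-injective x<n (i ↑ˡ H x)} {Stars.label-injective x<v i} ψ (λ j → ∈-allFin (ψ j)) adj agree
      where
      ψ : Fin 3 → Fin (3 + k′)
      ψ zero    = zero
      ψ (suc j) = suc (j ↑ˡ k′)
      adj : ∀ i j → StarAdj i j → StarAdj (ψ i) (ψ j)
      adj zero    (suc _) _ = tt
      adj (suc _) zero    _ = tt
      agree : ∀ j → Stars.label x<v i (ψ j) ≡ Paths.label x<n (i ↑ˡ H x) j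
      agree zero = refl
      agree (suc j) rewrite splitAt-↑ˡ 2 j k′ | splitAt-↑ˡ (M x) i (H x) = refl

  downlinked : 𝓛₁ (Star (2 + k′)) (suc w) n
  downlinked = Stars.designOfOrder ≅-refl , Paths.designOfOrder star₂≅path₃ ,
    (λ i → proj₁ (target i)) , λ i → subst (_≤ᴳ Stars.blockAt i) (sym (proj₂ (target i))) (path≤star _ _ _)
    where
    -- Every star is centred below `w`, hence at a point of the P₃-design even if `n` is `w`.
    x<n : ∀ i → proj₁ (locate M (suc w) i) < n
    x<n i = <-≤-trans (M-pos⇒< (proj₂ (locate M (suc w) i))) w≤n
    target : ∀ i → _
    target i = Paths.blockAt-position (x<n i) (proj₂ (locate M (suc w) i) ↑ˡ H _)

-- Necessity of the conditions

module Labelling {l : ℕ} {G : Graph ℕ} {Γ : Graph (Fin l)} (all : ∀ i → i ∈ vertices Γ) (iso : G ≅ Γ) where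

  open _≅_ iso

  name : Fin l → ℕ
  name i = proj₁ (from (i , all i))

  name-injective : ∀ {i j} → name i ≡ name j → i ≡ j
  name-injective {i} {j} eq = trans (sym (inverseˡ {i , all i} refl)) (inverseˡ {j , all j} {from (i , all i)} eq)

  name-∈ : ∀ i → name i ∈ vertices G
  name-∈ i = proj₂ (from (i , all i))

  name-adj : ∀ {i j} → Adj Γ i j → Adj G (name i) (name j)
  name-adj {i} {j} ij = Equivalence.from (adj⇔adj (from (i , all i)) (from (j , all j)))
    (subst₂ (Adj Γ) (sym (inverseˡ {i , all i} refl)) (sym (inverseˡ {j , all j} refl)) ij)

  adj-name : ∀ {u v} → Adj G u v → ∃₂ λ i j → name i ≡ u × name j ≡ v × Adj Γ i j
  adj-name {u} {v} uv = proj₁ (to u′) , proj₁ (to v′) ,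
    inverseʳ {u′} {proj₁ (to u′) , all _} refl , inverseʳ {v′} {proj₁ (to v′) , all _} refl ,
    Equivalence.to (adj⇔adj u′ v′) uv
    where
    u′ v′ : ∃ (_∈ vertices G)
    u′ = u , adj⇒∈ G uv
    v′ = v , adj⇒∈ G (adj-sym G uv)

lookup-injective : ∀ {A : Set} {xs : List A} → Unique xs → ∀ {i j} → lookup xs i ≡ lookup xs j → i ≡ j
lookup-injective (_ ∷ _)   {zero}  {zero}  _  = refl
lookup-injective (x∉ ∷ _)  {zero}  {suc j} eq = contradiction eq (All.lookup x∉ (∈-lookup j))
lookup-injective (x∉ ∷ _)  {suc i} {zero}  eq = contradiction (sym eq) (All.lookup x∉ (∈-lookup i))
lookup-injective (_ ∷ xs!) {suc i} {suc j} eq = cong suc (lookup-injective xs! eq)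

length-⊆ : ∀ {A : Set} {xs ys : List A} → Unique xs → xs ⊆ ys → length xs ≤ length ys
length-⊆ {xs = xs} {ys} xs! sub = injective⇒≤ {f = λ i → index (sub (∈-lookup i))} λ {i} {j} eq →
  lookup-injective xs! (trans (lookup-index (sub (∈-lookup i)))
    (trans (cong (lookup ys) eq) (sym (lookup-index (sub (∈-lookup j))))))

-- If some `z` of `xs` is missing from `ys`, the condition applied to the pairs with `z` puts all
-- other elements in `ys`.
length-⊆-but-one : ∀ {xs ys : List ℕ} → Unique xs →
                   (∀ {x y} → x ∈ xs → y ∈ xs → x ≢ y → x ∈ ys ⊎ y ∈ ys) → length xs ≤ suc (length ys)
length-⊆-but-one {xs} {ys} xs! meet with Any.any? (λ x → ¬? (x ∈? ys)) xs
... | no  all∈  = m≤n⇒m≤1+n (length-⊆ xs! λ {x} x∈ → decidable-stable (x ∈? ys) (all∈ ∘ lose x∈))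
... | yes some∉ with find some∉
...   | z , z∈ , z∉ = length-⊆ xs! sub
  where
  sub : xs ⊆ z ∷ ys
  sub {x} x∈ with x ≟ z
  ... | yes refl = here refl
  ... | no  x≢z  = [ there , (λ z∈ys → contradiction z∈ys z∉) ]′ (meet x∈ z∈ x≢z)

*-≤-injective : ∀ {a b c d} (f : Fin a × Fin b → Fin c × Fin d) → (∀ {x y} → f x ≡ f y → x ≡ y) → a * b ≤ c * d
*-≤-injective {a} {b} {c} {d} f f-inj = injective⇒≤ {f = λ i → code (f (remQuot {a} b i))} λ {i} {j} eq →
  trans (sym (combine-remQuot {a} b i)) (trans (cong code (f-inj (code-injective eq))) (combine-remQuot {a} b j))
  where
  code : ∀ {m n} → Fin m × Fin n → Fin (m * n)
  code (i , j) = combine i j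
  code-injective : ∀ {m n} {x y : Fin m × Fin n} → code x ≡ code y → x ≡ y
  code-injective {x = i , j} {k , l} eq with refl , refl ← combine-injective i j k l eq = refl

-- The two edges of the path, each in both directions.
source target : Fin 4 → Fin 3
source zero                   = zero
source (suc zero)             = suc zero
source (suc (suc zero))       = suc zero
source (suc (suc (suc zero))) = suc (suc zero)
target zero                   = suc zero
target (suc zero)             = zero
target (suc (suc zero))       = suc (suc zero)
target (suc (suc (suc zero))) = suc zero

source-target-adj : ∀ a → Adj (Path 3) (source a) (target a)
source-target-adj zero                   = inj₁ refl
source-target-adj (suc zero)             = inj₂ refl
source-target-adj (suc (suc zero))       = inj₁ refl
source-target-adj (suc (suc (suc zero))) = inj₂ refl

source-target-injective : ∀ {a b} → source a ≡ source b → target a ≡ target b → a ≡ b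
source-target-injective {zero}                   {zero}                   _  _ = refl
source-target-injective {zero}                   {suc zero}               () _
source-target-injective {zero}                   {suc (suc zero)}         () _
source-target-injective {zero}                   {suc (suc (suc zero))}   () _
source-target-injective {suc zero}               {suc zero}               _  _ = refl
source-target-injective {suc zero}               {suc (suc (suc zero))}   () _
source-target-injective {suc (suc zero)}         {suc (suc (suc zero))}   () _
source-target-injective {suc zero}               {suc (suc zero)}         _ ()
source-target-injective {suc (suc zero)}         {suc zero}               _ ()
source-target-injective {suc (suc zero)}         {suc (suc zero)}         _  _ = refl
source-target-injective {suc (suc (suc zero))}   {suc (suc (suc zero))}   _  _ = refl

path₃-arc : ∀ {i j} → Adj (Path 3) i j → ∃ λ a → source a ≡ i × target a ≡ j
path₃-arc {zero}         {suc zero}       (inj₁ refl) = zero , refl , refl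
path₃-arc {suc zero}     {zero}           (inj₂ refl) = suc zero , refl , refl
path₃-arc {suc zero}     {suc (suc zero)} (inj₁ refl) = suc (suc zero) , refl , refl
path₃-arc {suc (suc zero)} {zero}         (inj₁ ())
path₃-arc {suc (suc zero)} {suc zero}     (inj₁ ())
path₃-arc {suc (suc zero)} {suc (suc zero)} (inj₁ ())
path₃-arc {suc (suc zero)} {suc zero}     (inj₂ refl) = suc (suc (suc zero)) , refl , refl

module _ {x : ℕ} {xs : List ℕ} {u : Unique (x ∷ xs)} (D : Design (Complete (x ∷ xs) u) (Path 3)) where

  private
    module Block b = Labelling ∈-allFin (block-≅ D b)

    K = Complete (x ∷ xs) u

    Pair Arc : Set
    Pair = Fin (length (x ∷ xs)) × Fin (length xs)
    Arc  = Fin (size D) × Fin 4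

    -- `punchIn i` skips the index `i`, so these are the ordered pairs of distinct points.
    α : Pair → ℕ × ℕ
    α (i , j) = lookup (x ∷ xs) i , lookup (x ∷ xs) (punchIn i j)

    β : Arc → ℕ × ℕ
    β (b , a) = Block.name b (source a) , Block.name b (target a)

    α-injective : ∀ {p q} → α p ≡ α q → p ≡ q
    α-injective {i , j} {k , l} eq with ,-injective eq
    ... | eq₁ , eq₂ with lookup-injective u {i} {k} eq₁
    ...   | refl = cong (i ,_) (punchIn-injective i j l (lookup-injective u {punchIn i j} {punchIn i l} eq₂))

    β-adj : ∀ b a → Adj (block D b) (proj₁ (β (b , a))) (proj₂ (β (b , a)))
    β-adj b a = Block.name-adj b (source-target-adj a)

    β-injective : ∀ {p q} → β p ≡ β q → p ≡ q
    β-injective {b , a} {c , d} eq with ,-injective eq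
    ... | eq₁ , eq₂ with partition D (proj₂ (block-≤ D b) (β-adj b a))
    ...   | _ , _ , only with trans (sym (only (β-adj b a)))
                                    (only (subst₂ (Adj (block D c)) (sym eq₁) (sym eq₂) (β-adj c d)))
    ...     | refl = cong (b ,_) (source-target-injective (Block.name-injective b eq₁) (Block.name-injective b eq₂))

    arcOf : ∀ p → ∃ λ q → β q ≡ α p
    arcOf (i , j) with partition D (∈-lookup {xs = x ∷ xs} i , ∈-lookup {xs = x ∷ xs} (punchIn i j) ,
                                    λ eq → punchInᵢ≢i i j (sym (lookup-injective u {i} {punchIn i j} eq)))
    ... | b , adj , _ with Block.adj-name b adj
    ...   | _ , _ , s≡ , t≡ , st with path₃-arc st
    ...     | a , refl , refl = (b , a) , cong₂ _,_ s≡ t≡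

    pairOf : ∀ q → ∃ λ p → α p ≡ β q
    pairOf (b , a) with proj₂ (block-≤ D b) (β-adj b a)
    ... | s∈ , t∈ , s≢t = (index s∈ , punchOut i≢j) ,
      cong₂ _,_ (sym (lookup-index s∈))
                (trans (cong (lookup (x ∷ xs)) (punchIn-punchOut i≢j)) (sym (lookup-index t∈)))
      where
      i≢j : index s∈ ≢ index t∈
      i≢j eq = s≢t (trans (lookup-index s∈) (trans (cong (lookup (x ∷ xs)) eq) (sym (lookup-index t∈))))

  -- Ordered pairs of distinct points and arcs of blocks have the same images in `ℕ × ℕ`, and both
  -- maps are injective; this gives an injection in each direction.
  path₃-design-size : length (x ∷ xs) * length xs ≡ size D * 4
  path₃-design-size = ≤-antisym
    (*-≤-injective (proj₁ ∘ arcOf) (λ {p} {q} eq →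
      α-injective (trans (sym (proj₂ (arcOf p))) (trans (cong β eq) (proj₂ (arcOf q))))))
    (*-≤-injective (proj₁ ∘ pairOf) (λ {p} {q} eq →
      β-injective (trans (sym (proj₂ (pairOf p))) (trans (cong α eq) (proj₂ (pairOf q))))))

path₃-design⇒4∣ : ∀ n → DesignOfOrder n (Path 3) → 4 ∣ n * pred n
path₃-design⇒4∣ _ D with points D | distinct-points D | order D | design D
... | []     | _ | refl | _ = 4 ∣0
... | x ∷ xs | u | refl | E = divides (size E) (path₃-design-size {u = u} E)

4∤4c+2 : ∀ c → ¬ (4 ∣ 4 * c + 2)
4∤4c+2 c 4∣ = >⇒∤ (s≤s (s≤s (s≤s z≤n))) (∣m+n∣m⇒∣n {m = 4 * c} 4∣ (m∣m*n c))

-- If `n` is 2 or 3 modulo 4, the product is 2 modulo 4.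
4∣⇒residue : ∀ n → 4 ∣ n * pred n → n % 4 ≡ 0 ⊎ n % 4 ≡ 1
4∣⇒residue n 4∣ with n % 4 | m≡m%n+[m/n]*n n 4 | m%n<n n 4
... | 0 | _  | _ = inj₁ refl
... | 1 | _  | _ = inj₂ refl
... | 2 | eq | _ = contradiction (subst (4 ∣_) (trans (cong (λ m → m * pred m) eq) (lemma (n / 4))) 4∣) (4∤4c+2 (3 * (n / 4) + 4 * (n / 4) * (n / 4)))
  where
  lemma : ∀ q → (2 + q * 4) * (1 + q * 4) ≡ 4 * (3 * q + 4 * q * q) + 2
  lemma = solve-∀
... | 3 | eq | _ = contradiction (subst (4 ∣_) (trans (cong (λ m → m * pred m) eq) (lemma (n / 4))) 4∣) (4∤4c+2 (1 + 5 * (n / 4) + 4 * (n / 4) * (n / 4)))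
  where
  lemma : ∀ q → (3 + q * 4) * (2 + q * 4) ≡ 4 * (1 + 5 * q + 4 * q * q) + 2
  lemma = solve-∀
... | suc (suc (suc (suc _))) | _ | s≤s (s≤s (s≤s (s≤s ())))

residue⇒4∣ : ∀ n → n % 4 ≡ 0 ⊎ n % 4 ≡ 1 → 4 ∣ n * pred n
residue⇒4∣ n (inj₁ r≡0) = ∣m⇒∣m*n (pred n) (m%n≡0⇒n∣m n 4 r≡0)
residue⇒4∣ n (inj₂ r≡1) = ∣n⇒∣m*n n (divides (n / 4)
  (cong pred (trans (m≡m%n+[m/n]*n n 4) (cong (_+ n / 4 * 4) r≡1))))

module _ {k v n : ℕ} (link : 𝓛₁ (Star k) v n) where

  private
    𝓑 = proj₁ link
    𝓑′ = proj₁ (proj₂ link)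
    f = proj₁ (proj₂ (proj₂ link))
    f-≤ = proj₂ (proj₂ (proj₂ link))
    module Stars i = Labelling ∈-allFin (block-≅ (design 𝓑) i)
    module Paths i = Labelling ∈-allFin (block-≅ (design 𝓑′) i)

    middle-is-centre : ∀ {l} {i j h : Fin (suc l)} → StarAdj i j → StarAdj j h → i ≢ h → j ≡ zero
    middle-is-centre {j = zero}  _ _ _ = refl
    middle-is-centre {i = zero} {suc j} {zero} _ _ i≢h = contradiction refl i≢h

    -- The middle vertex of the linked P₃ has two distinct neighbours in the star, hence is its
    -- centre.
    centre∈ : ∀ i → Stars.name i zero ∈ points 𝓑′
    centre∈ i with Stars.adj-name i (proj₂ (f-≤ i) (Paths.name-adj (f i) {zero} {suc zero} (inj₁ refl)))
                 | Stars.adj-name i (proj₂ (f-≤ i) (Paths.name-adj (f i) {suc zero} {suc (suc zero)} (inj₁ refl)))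
    ... | a , b , a≡ , b≡ , ab | b′ , c , b′≡ , c≡ , bc
      with refl ← Stars.name-injective i (trans b≡ (sym b′≡))
      with refl ← middle-is-centre ab bc
             (λ a≡c → contradiction (Paths.name-injective (f i) (trans (sym a≡) (trans (cong (Stars.name i) a≡c) c≡))) λ ())
      = subst (_∈ points 𝓑′) (sym b≡) (proj₁ (block-≤ (design 𝓑′) (f i)) (Paths.name-∈ (f i) (suc zero)))

    -- The edge joining `x` and `y` lies in a star, and one of its ends is the centre.
    meet : ∀ {x y} → x ∈ points 𝓑 → y ∈ points 𝓑 → x ≢ y → x ∈ points 𝓑′ ⊎ y ∈ points 𝓑′
    meet x∈ y∈ x≢y with partition (design 𝓑) (x∈ , y∈ , x≢y)
    ... | i , adj , _ with Stars.adj-name i adj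
    ...   | zero  , suc _ , refl , _ , _ = inj₁ (centre∈ i)
    ...   | suc _ , zero  , _ , refl , _ = inj₂ (centre∈ i)

  downlink⇒order : v ∸ 1 ≤ n
  downlink⇒order = ∸-monoˡ-≤ 1 (subst₂ (λ v n → v ≤ suc n) (order 𝓑) (order 𝓑′) (length-⊆-but-one (distinct-points 𝓑) meet))

-- Choice of the parameters, and the two inclusions.

downlink-exists : ∀ k′ q a r n → let k = 2 + k′; w = a + r in 2 ≤ k′ → 2 * k ≤ w → w ≤ n →
                  w * suc w ≡ 2 * k * (q * w + r) → 4 ∣ n * pred n → 𝓛₁ (Star k) (suc w) n
downlink-exists k′ q a r n 2≤k′ 2k≤w w≤n eq 4∣ with balanced-tournament (2 + k′) q a r 2k≤w eq
... | T , t , out , scores = Construction.downlinked 2≤k′ (<-≤-trans (s≤s z≤n) 2k≤w) w≤n t out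
  (multiplicity-positive k q a r 2k≤w eq) scores
  -- Vertex 0 has the least multiplicity, hence the least score.
  (λ x<w → +-cancelʳ-≤ 1 _ _ (subst₂ _≤_ (sym (scores (<-≤-trans (s≤s z≤n) 2k≤w))) (sym (scores x<w))
    (*-monoʳ-≤ k (multiplicity-mono k q a r 2k≤w eq z≤n)))) 4∣
  where k = 2 + k′

downlinks : (k : ℕ) → 3 < k → (v : ℕ) → v ≥ 4 * k → 2 * k ∣ v * (v ∸ 1) →
            ∀ {n} → n ≥ v ∸ 1 → 4 ∣ n * pred n → 𝓛₁ (Star k) v n
downlinks (suc (suc k′)) (s≤s (s≤s 2≤k′)) (suc w) v≥4k (divides M eq) {n} w≤n 4∣ =
  subst (λ w → 𝓛₁ (Star k) (suc w) n) a+r≡w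
    -- `M` is the number of stars; spread as evenly as possible over `w` centres, it gives `M % w`
    -- of them one star more than the others.
    (downlink-exists k′ (M / w) (w ∸ M % w) (M % w) n 2≤k′
      (subst (2 * k ≤_) (sym a+r≡w) 2k≤w) (subst (_≤ n) (sym a+r≡w) w≤n)
      (subst (λ w′ → w′ * suc w′ ≡ 2 * k * (M / w * w′ + M % w)) (sym a+r≡w) edges) 4∣)
  where
  k = suc (suc k′)
  2k≤w : 2 * k ≤ w
  2k≤w = ≤-pred (begin
    suc (2 * k)    ≤⟨ +-monoˡ-≤ (2 * k) {1} {2 * k} (s≤s z≤n) ⟩
    2 * k + 2 * k  ≡⟨ *-distribʳ-+ k 2 2 ⟨
    4 * k          ≤⟨ v≥4k ⟩
    suc w          ∎)
    where open ≤-Reasoning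
  instance
    w-nonZero : NonZero w
    w-nonZero = >-nonZero (<-≤-trans (s≤s z≤n) 2k≤w)
  a+r≡w : w ∸ M % w + M % w ≡ w
  a+r≡w = m∸n+n≡m (<⇒≤ (m%n<n M w))
  edges : w * suc w ≡ 2 * k * (M / w * w + M % w)
  edges = begin
    w * suc w                        ≡⟨ *-comm w (suc w) ⟩
    suc w * w                        ≡⟨ eq ⟩
    M * (2 * k)                      ≡⟨ *-comm M (2 * k) ⟩
    2 * k * M                        ≡⟨ cong (2 * k *_) (trans (m≡m%n+[m/n]*n M w) (+-comm (M % w) _)) ⟩
    2 * k * (M / w * w + M % w)      ∎
    where open ≡-Reasoning

theorem5p2 : (k : ℕ) → 3 < k → (v : ℕ) → v ≥ 4 * k → 2 * k ∣ v * (v ∸ 1) →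
    𝓛₁ (Star k) v ≐ (λ n → n ≥ v ∸ 1 × (n % 4 ≡ 0 ⊎ n % 4 ≡ 1))
theorem5p2 k 3<k v v≥4k 2k∣ =
  (λ {n} link → downlink⇒order link , 4∣⇒residue n (path₃-design⇒4∣ n (proj₁ (proj₂ link)))) ,
  λ {n} (n≥ , residue) → downlinks k 3<k v v≥4k 2k∣ n≥ (residue⇒4∣ n residue)
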